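{- Let $r\ge 0$ and $n$ be integers with $n>r+1$, and let $C_{2n+1}$ denote the cycle on $2n+1$ vertices. Then $\omega(\mathcal M^{2r}(C_{2n+1}))=2$, $\alpha^\circ(\mathcal M^{2r}(C_{2n+1}))=2r+2$, and $\chi(\mathcal M^{2r}(C_{2n+1}))=2r+3$.
   Context: All graphs are finite, undirected and simple; $\chi$ denotes the chromatic number and $\omega$ the clique number. The length of a cycle is its number of vertices. Circular altitude. A circular ordering $\sigma$ of $V(G)$ is a one-to-one assignment of $V(G)$ to the vertices of a directed cycle. A cycle $u_1,u_2,\ldots,u_n$ of $G$ is monotonic for $\sigma$ if $u_1,\ldots,u_n,u_1$ appear in this circular order in $\sigma$. Edges of $G$ are regarded as monotonic cycles of length two. The circular altitude $\alpha^\circ(G)$ of a graph $G$ with at least one edge is the largest $k$ such that every circular ordering of $V(G)$ contains a monotonic cycle of length at least $k$. Mycielskian. Given a graph $G$, the Mycielskian $\mathcal M(G)$ has vertex set $\{w\}\cup\{a^u \mid a\in V(G)\}\cup\{a^v\mid a\in V(G)\}$ (all these vertices distinct; $u,v$ are formal labels). Its edges are: $a^v b^v$, $a^u b^v$ and $b^u a^v$ for every edge $ab$ of $G$, and $w a^u$ for every $a\in V(G)$; there are no other edges. $\mathcal M^0(G)=G$ and $\mathcal M^{d}(G)=\mathcal M(\mathcal M^{d-1}(G))$ for $d\ge 1$. -}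

module Defs where

open import Data.Nat using (ℕ; zero; suc; _+_; _≤_; _≥_)
import Data.Nat.Properties as ℕₚ
open import Data.Fin using (Fin; toℕ; _<_)
open import Data.Fin.Properties using (+↔⊎; _≟_)
import Data.Fin as Fin
open import Data.Product using (Σ; ∃; _×_; _,_)
open import Data.Sum using (_⊎_; inj₁; inj₂; swap)
open import Data.Sum.Algebra using (⊎-cong)
open import Function using (_∘_)
open import Function.Bundles using (_↔_; _↣_; Inverse; Injection; mk↔ₛ′)
open import Function.Construct.Composition using (_↔-∘_)
open import Function.Construct.Identity using (↔-id)
open import Function.Construct.Symmetry using (↔-sym)
open import Relation.Binary.Definitions using (Symmetric; Irreflexive; Decidable)
open import Relation.Binary.PropositionalEquality using (_≡_; _≢_; refl; sym)
open import Relation.Nullary using (yes; no)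
open import Relation.Nullary.Decidable using (_×-dec_; _⊎-dec_; ¬?; map′)

record Graph : Set₁ where
  field
    V         : Set
    order     : ℕ
    enumerate : V ↔ Fin order
    Adj       : V → V → Set
    adj?      : Decidable Adj
    adj-sym   : Symmetric Adj
    adj-irr   : Irreflexive _≡_ Adj

IsLeast : (ℕ → Set) → ℕ → Set
IsLeast P k = P k × (∀ m → P m → k ≤ m)

IsGreatest : (ℕ → Set) → ℕ → Set
IsGreatest P k = P k × (∀ m → P m → m ≤ k)

-- The arcs of the directed cycle 0 → 1 → … → m-1 → 0.
data _⟶_ {m : ℕ} (i j : Fin m) : Set where
  step : toℕ j ≡ suc (toℕ i) → i ⟶ j
  wrap : suc (toℕ i) ≡ m → toℕ j ≡ 0 → i ⟶ j

-- Going around that directed cycle from i, one meets j and then k before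
-- returning to i (in particular, i, j and k are distinct).
CyclicOrder : {m : ℕ} → Fin m → Fin m → Fin m → Set
CyclicOrder i j k =
  (i < j × j < k) ⊎ (j < k × k < i) ⊎ (k < i × i < j)

module _ (G : Graph) where
  open Graph G

  Colorable : ℕ → Set
  Colorable k = Σ (V → Fin k) λ c → ∀ {x y} → Adj x y → c x ≢ c y

  HasClique : ℕ → Set
  HasClique k = Σ (Fin k ↣ V) λ f →
    ∀ {i j} → i ≢ j → Adj (Injection.to f i) (Injection.to f j)

  IsChromaticNumber : ℕ → Set
  IsChromaticNumber = IsLeast Colorable

  IsCliqueNumber : ℕ → Set
  IsCliqueNumber = IsGreatest HasClique

  -- Fin order stands for the vertices of the directed cycle _⟶_.
  CircularOrdering : Set
  CircularOrdering = V ↔ Fin order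

  record Cycle (k : ℕ) : Set where
    field
      length≥3 : 3 ≤ k
      vertices : Fin k ↣ V
    u : Fin k → V
    u = Injection.to vertices
    field
      adjacent : ∀ {i j} → i ⟶ j → Adj (u i) (u j)

  data MonotonicCycle (σ : CircularOrdering) : ℕ → Set where
    edge  : ∀ {x y} → Adj x y → MonotonicCycle σ 2
    cycle : ∀ {k} (c : Cycle k) → (let pos = Inverse.to σ ∘ Cycle.u c) →
            (∀ {i j l} → i < j → j < l → CyclicOrder (pos i) (pos j) (pos l)) →
            MonotonicCycle σ k

  -- For an edgeless graph, where the circular altitude is undefined, no number
  -- satisfies this predicate.
  IsCircularAltitude : ℕ → Set
  IsCircularAltitude = IsGreatest λ k →
    (σ : CircularOrdering) → ∃ λ l → l ≥ k × MonotonicCycle σ l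

_⟶?_ : {m : ℕ} → Decidable (_⟶_ {m})
_⟶?_ {m} i j =
  map′ (λ { (inj₁ p) → step p ; (inj₂ (p , q)) → wrap p q })
       (λ { (step p) → inj₁ p ; (wrap p q) → inj₂ (p , q) })
       ((toℕ j ℕₚ.≟ suc (toℕ i)) ⊎-dec
        ((suc (toℕ i) ℕₚ.≟ m) ×-dec (toℕ j ℕₚ.≟ 0)))

-- The cycle on m vertices for m ≥ 3; the condition i ≢ j only serves to avoid
-- a loop in the degenerate case m = 1.
C : ℕ → Graph
C m = record
  { V         = Fin m
  ; order     = m
  ; enumerate = ↔-id (Fin m)
  ; Adj       = λ i j → i ≢ j × (i ⟶ j ⊎ j ⟶ i)
  ; adj?      = λ i j → ¬? (i ≟ j) ×-dec ((i ⟶? j) ⊎-dec (j ⟶? i))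
  ; adj-sym   = λ (i≢j , a) → (i≢j ∘ sym) , swap a
  ; adj-irr   = λ i≡j (i≢j , _) → i≢j i≡j
  }

data MycielskiV (A : Set) : Set where
  w  : MycielskiV A
  _ᵘ : A → MycielskiV A
  _ᵛ : A → MycielskiV A

data MycielskiAdj {A : Set} (R : A → A → Set) :
                  MycielskiV A → MycielskiV A → Set where
  vv : ∀ {a b} → R a b → MycielskiAdj R (a ᵛ) (b ᵛ)
  uv : ∀ {a b} → R a b → MycielskiAdj R (a ᵘ) (b ᵛ)
  vu : ∀ {a b} → R a b → MycielskiAdj R (a ᵛ) (b ᵘ)
  wu : ∀ {a} → MycielskiAdj R w (a ᵘ)
  uw : ∀ {a} → MycielskiAdj R (a ᵘ) w

module _ (G : Graph) where
  open Graph G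

  private
    enumerateᴹ : MycielskiV V ↔ Fin (1 + (order + order))
    enumerateᴹ =
      ↔-sym (+↔⊎ {1} {order + order}) ↔-∘
      (⊎-cong (↔-id (Fin 1)) (↔-sym (+↔⊎ {order} {order}) ↔-∘
                              ⊎-cong enumerate enumerate) ↔-∘
       mk↔ₛ′ (λ { w → inj₁ Fin.zero ; (a ᵘ) → inj₂ (inj₁ a) ; (a ᵛ) → inj₂ (inj₂ a) })
             (λ { (inj₁ _) → w ; (inj₂ (inj₁ a)) → a ᵘ ; (inj₂ (inj₂ a)) → a ᵛ })
             (λ { (inj₁ Fin.zero) → refl ; (inj₂ (inj₁ _)) → refl ; (inj₂ (inj₂ _)) → refl })
             (λ { w → refl ; (_ ᵘ) → refl ; (_ ᵛ) → refl }))

    adjᴹ? : Decidable (MycielskiAdj Adj)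
    adjᴹ? w     w     = no λ ()
    adjᴹ? w     (_ ᵘ) = yes wu
    adjᴹ? w     (_ ᵛ) = no λ ()
    adjᴹ? (_ ᵘ) w     = yes uw
    adjᴹ? (_ ᵘ) (_ ᵘ) = no λ ()
    adjᴹ? (a ᵘ) (b ᵛ) = map′ uv (λ { (uv p) → p }) (adj? a b)
    adjᴹ? (_ ᵛ) w     = no λ ()
    adjᴹ? (a ᵛ) (b ᵘ) = map′ vu (λ { (vu p) → p }) (adj? a b)
    adjᴹ? (a ᵛ) (b ᵛ) = map′ vv (λ { (vv p) → p }) (adj? a b)

    symᴹ : Symmetric (MycielskiAdj Adj)
    symᴹ (vv p) = vv (adj-sym p)
    symᴹ (uv p) = vu (adj-sym p)
    symᴹ (vu p) = uv (adj-sym p)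
    symᴹ wu     = uw
    symᴹ uw     = wu

    irrᴹ : Irreflexive _≡_ (MycielskiAdj Adj)
    irrᴹ refl (vv p) = adj-irr refl p

  ℳ : Graph
  ℳ = record
    { V         = MycielskiV V
    ; order     = 1 + (order + order)
    ; enumerate = enumerateᴹ
    ; Adj       = MycielskiAdj Adj
    ; adj?      = adjᴹ?
    ; adj-sym   = symᴹ
    ; adj-irr   = irrᴹ
    }

ℳ^ : ℕ → Graph → Graph
ℳ^ zero    G = G
ℳ^ (suc d) G = ℳ (ℳ^ d G)

{-# OPTIONS --safe #-}

-- Lower bounds: a Ky Fan type parity argument on the box complex (signed vertices, opposite
-- signs adjacent) produces symmetric cycles whose number of simplices alternating in sign is
-- odd for every ordering c of the vertices.  An odd cycle carries one of dimension 2, and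
-- suspending it passes to the Mycielskian in one dimension higher.  For a proper c one thus
-- gets x₀, …, x_{2r+2} with strictly increasing c, where xᵢ and xⱼ are adjacent if i − j is
-- odd.  If c is a colouring it has 2r+3 colours; if c is a circular ordering then
-- x₀, …, x_{2r+1} is a monotonic cycle.
--
-- Upper bound on the altitude: order the vertices by a (2r+3)-colouring in which a monotonic
-- cycle of length 2r+3, which meets the colours in cyclic order, cannot pass through any of
-- the vertices w.  It projects to an odd closed walk of length 2r+3 < 2n+1 in the cycle.
module Submission where

open import Defs
open import Data.Bool using (Bool; true; false; not; _xor_; if_then_else_)
open import Data.Bool.Properties
  using (not-¬; not-involutive; xor-comm; xor-identityʳ)
open import Data.Bool.Solver using (module xor-∧-Solver)
open import Data.Empty using (⊥)
open import Data.Fin using (Fin; zero; suc; toℕ; fromℕ; fromℕ<; inject₁; inject≤; punchIn)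
import Data.Fin as Fin
open import Data.Fin.Permutation using () renaming (insert to insertₚ)
open import Data.Fin.Properties
  using (toℕ<n; toℕ-fromℕ; toℕ-fromℕ<; fromℕ<-toℕ; toℕ-inject₁; toℕ-inject≤; toℕ-injective;
         punchIn-mono-≤; injective⇒≤; <-cmp)
open import Data.List using (List; []; _∷_; _++_; map; concatMap; length; downFrom; lookup)
open import Data.List.Membership.Propositional using (_∈_; find)
open import Data.List.Membership.Propositional.Properties
  using (∈-map⁺; ∈-map⁻; ∈-++⁻; ∈-concatMap⁻; ∈-lookup)
open import Data.List.Properties using (map-∘; map-cong; map-id; length-map)
open import Data.List.Relation.Unary.All using (All; []; _∷_)
import Data.List.Relation.Unary.All as All
open import Data.List.Relation.Unary.AllPairs using (AllPairs; []; _∷_)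
open import Data.List.Relation.Unary.Any using (here; there)
open import Data.Nat
  using (ℕ; zero; suc; _+_; _*_; _≤_; _<_; _>_; _≟_; _≤?_; _<?_; s≤s; z≤n; NonZero)
open import Data.Nat.DivMod
  using (_%_; _mod_; m%n<n; m%n%n≡m%n; m<n⇒m%n≡m; n%n≡0; [m+n]%n≡m%n; [m+kn]%n≡m%n; %-distribˡ-+)
open import Data.Nat.Properties hiding (_≟_; _≤?_; _<?_; <-cmp)
open import Data.Nat.Solver using (module +-*-Solver)
open import Data.Product using (∃; Σ; _×_; _,_; proj₁; proj₂)
open import Data.Sum using (_⊎_; inj₁; inj₂)
open import Data.Unit using (⊤; tt)
open import Function using (_∘_)
open import Function.Bundles using (_↔_; Inverse; Injection; mk↣)
open import Function.Construct.Composition using (_↔-∘_)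
open import Function.Construct.Identity using (↔-id)
open import Function.Properties.Inverse using (↔⇒↣)
open import Relation.Binary.Definitions using (tri<; tri≈; tri>)
open import Relation.Binary.PropositionalEquality
open import Relation.Nullary using (Dec; yes; no; ¬_; contradiction)

open xor-∧-Solver using () renaming (solve to xorSolve; _:=_ to _:≡_; _:+_ to _⊞_; con to constant)

-- Chains modulo 2

-- A list stands for the formal sum of its entries modulo 2, and ∑ pairs it with
-- a cochain.
∑ : {A : Set} → List A → (A → Bool) → Bool
∑ []       φ = false
∑ (x ∷ xs) φ = φ x xor ∑ xs φ

∑-cong : ∀ {A : Set} {φ ψ : A → Bool} (xs : List A) → (∀ x → φ x ≡ ψ x) → ∑ xs φ ≡ ∑ xs ψ
∑-cong []       eq = refl
∑-cong (x ∷ xs) eq = cong₂ _xor_ (eq x) (∑-cong xs eq)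

∑-cong-All : ∀ {A : Set} {φ ψ : A → Bool} {xs} → All (λ x → φ x ≡ ψ x) xs → ∑ xs φ ≡ ∑ xs ψ
∑-cong-All []         = refl
∑-cong-All (eq ∷ eqs) = cong₂ _xor_ eq (∑-cong-All eqs)

∑-++ : ∀ {A : Set} (φ : A → Bool) xs ys → ∑ (xs ++ ys) φ ≡ ∑ xs φ xor ∑ ys φ
∑-++ φ []       ys = refl
∑-++ φ (x ∷ xs) ys rewrite ∑-++ φ xs ys =
  xorSolve 3 (λ a b c → a ⊞ (b ⊞ c) :≡ (a ⊞ b) ⊞ c) refl (φ x) (∑ xs φ) (∑ ys φ)

∑-map : ∀ {A B : Set} (φ : B → Bool) (f : A → B) xs → ∑ (map f xs) φ ≡ ∑ xs (φ ∘ f)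
∑-map φ f []       = refl
∑-map φ f (x ∷ xs) = cong (φ (f x) xor_) (∑-map φ f xs)

∑-concatMap : ∀ {A B : Set} (φ : B → Bool) (f : A → List B) xs →
              ∑ (concatMap f xs) φ ≡ ∑ xs (λ x → ∑ (f x) φ)
∑-concatMap φ f []       = refl
∑-concatMap φ f (x ∷ xs) =
  trans (∑-++ φ (f x) (concatMap f xs)) (cong (∑ (f x) φ xor_) (∑-concatMap φ f xs))

∑-xor : ∀ {A : Set} (φ ψ : A → Bool) xs → ∑ xs (λ x → φ x xor ψ x) ≡ ∑ xs φ xor ∑ xs ψ
∑-xor φ ψ []       = refl
∑-xor φ ψ (x ∷ xs) rewrite ∑-xor φ ψ xs =
  xorSolve 4 (λ a b c d → (a ⊞ b) ⊞ (c ⊞ d) :≡ (a ⊞ c) ⊞ (b ⊞ d)) refl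
    (φ x) (ψ x) (∑ xs φ) (∑ xs ψ)

∑-zero : ∀ {A : Set} (xs : List A) → ∑ xs (λ _ → false) ≡ false
∑-zero []       = refl
∑-zero (_ ∷ xs) = ∑-zero xs

∑-true : ∀ {A : Set} (φ : A → Bool) xs → ∑ xs φ ≡ true → ∃ λ x → x ∈ xs × φ x ≡ true
∑-true φ (x ∷ xs) eq with φ x in φx
... | true  = x , here refl , φx
... | false with y , y∈ , φy ← ∑-true φ xs eq = y , there y∈ , φy

-- By telescoping, the two sums differ by `f 0` and `f m`. This rotates a sum taken around a closed
-- walk.
∑-shift : ∀ (f : ℕ → Bool) m → f m ≡ f 0 → ∑ (downFrom m) (f ∘ suc) ≡ ∑ (downFrom m) f
∑-shift f m fm≡f0 = cancel (f 0) (trans (telescope m) (cong (_xor ∑ (downFrom m) f) fm≡f0))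
  where
  telescope : ∀ k → f 0 xor ∑ (downFrom k) (f ∘ suc) ≡ f k xor ∑ (downFrom k) f
  telescope zero    = refl
  telescope (suc k) = begin
    f 0 xor (f (suc k) xor ∑ (downFrom k) (f ∘ suc))
      ≡⟨ xorSolve 3 (λ a b c → a ⊞ (b ⊞ c) :≡ b ⊞ (a ⊞ c)) refl (f 0) (f (suc k)) _ ⟩
    f (suc k) xor (f 0 xor ∑ (downFrom k) (f ∘ suc))
      ≡⟨ cong (f (suc k) xor_) (telescope k) ⟩
    f (suc k) xor (f k xor ∑ (downFrom k) f) ∎
    where open ≡-Reasoning
  cancel : ∀ a {b c} → a xor b ≡ a xor c → b ≡ c
  cancel false eq = eq
  cancel true {b} {c} eq = trans (sym (not-involutive b)) (trans (cong not eq) (not-involutive c))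

-- Here the odd length of a closed walk becomes a nonzero invariant.
∑-const-true : ∀ n → ∑ (downFrom (suc (n + n))) (λ _ → true) ≡ true
∑-const-true n = trans (cong not (even n)) refl
  where
  even : ∀ n → ∑ (downFrom (n + n)) (λ _ → true) ≡ false
  even zero    = refl
  even (suc n) rewrite +-comm n (suc n) = trans (not-involutive _) (even n)

-- The boundary of an ordered simplex; modulo 2 no signs are kept. Entries may repeat, and the empty
-- list is the face of a one-element list, so the complex is augmented.
faces : {A : Set} → List A → List (List A)
faces []      = []
faces (x ∷ l) = l ∷ map (x ∷_) (faces l)

faces-All : ∀ {A : Set} {P : A → Set} {l} → All P l → All (All P) (faces l)
faces-All []       = []
faces-All {l = x ∷ l} (p ∷ ps) = ps ∷ go (faces-All ps)
  where
  go : ∀ {ls} → All (All _) ls → All (All _) (map (x ∷_) ls)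
  go []         = []
  go (qs ∷ qss) = (p ∷ qs) ∷ go qss

-- The coboundary. The boundary of a chain is described by pairing the chain with `δ φ` for all `φ`,
-- which avoids comparing lists of simplices up to order and cancellation.
δ : {A : Set} → (List A → Bool) → List A → Bool
δ φ l = ∑ (faces l) φ

δ-∷ : ∀ {A : Set} (φ : List A → Bool) x l → δ φ (x ∷ l) ≡ φ l xor δ (φ ∘ (x ∷_)) l
δ-∷ φ x l = cong (φ l xor_) (∑-map φ (x ∷_) (faces l))

δ-map : ∀ {A B : Set} (φ : List B → Bool) (f : A → B) l → δ φ (map f l) ≡ δ (φ ∘ map f) l
δ-map φ f []      = refl
δ-map φ f (x ∷ l) =
  trans (δ-∷ φ (f x) (map f l))
        (trans (cong (φ (map f l) xor_) (δ-map (φ ∘ (f x ∷_)) f l))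
               (sym (δ-∷ (φ ∘ map f) x l)))

-- The standard triangulation of the prism over an ordered simplex: initial vertices are taken at
-- the bottom `f`, final ones at the top `g`, and one vertex at both.
prism : {A B : Set} → (f g : A → B) → List A → List (List B)
prism f g []      = []
prism f g (x ∷ l) = (f x ∷ g x ∷ map g l) ∷ map (f x ∷_) (prism f g l)

-- The chain homotopy formula: the boundary consists of bottom, top and the prisms over the faces.
-- In the induction on the first vertex, the term `b` is the wall between the first simplex and the
-- remaining ones, and cancels.
prism-boundary : ∀ {A B : Set} (f g : A → B) (φ : List B → Bool) l →
  ∑ (prism f g l) (δ φ) ≡
  (φ (map f l) xor φ (map g l)) xor δ (λ m → ∑ (prism f g m) φ) l
prism-boundary f g φ [] = xorSolve 1 (λ a → constant false :≡ (a ⊞ a) ⊞ constant false) refl (φ [])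
prism-boundary f g φ (x ∷ l) = begin
  δ φ (f x ∷ g x ∷ map g l) xor ∑ (map (f x ∷_) (prism f g l)) (δ φ)
    ≡⟨ cong₂ _xor_ first rest ⟩
  (a xor (b xor c)) xor (d xor ((e xor b) xor k))
    ≡⟨ xorSolve 6 (λ a b c d e k →
         (a ⊞ (b ⊞ c)) ⊞ (d ⊞ ((e ⊞ b) ⊞ k)) :≡ (e ⊞ a) ⊞ (d ⊞ (c ⊞ k)))
         refl a b c d e k ⟩
  (e xor a) xor (d xor (c xor k))
    ≡⟨ cong ((e xor a) xor_) last ⟨
  (e xor a) xor δ (λ m → ∑ (prism f g m) φ) (x ∷ l) ∎
  where
  open ≡-Reasoning
  φₓ = φ ∘ (f x ∷_)
  a = φ (g x ∷ map g l)
  b = φₓ (map g l)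
  c = δ (λ m → φₓ (g x ∷ map g m)) l
  d = ∑ (prism f g l) φ
  e = φₓ (map f l)
  k = δ (λ m → ∑ (prism f g m) φₓ) l
  first : δ φ (f x ∷ g x ∷ map g l) ≡ a xor (b xor c)
  first = trans (δ-∷ φ (f x) (g x ∷ map g l))
    (cong (a xor_) (trans (δ-∷ φₓ (g x) (map g l))
      (cong (b xor_) (δ-map (φₓ ∘ (g x ∷_)) g l))))
  rest : ∑ (map (f x ∷_) (prism f g l)) (δ φ) ≡ d xor ((e xor b) xor k)
  rest = begin
    ∑ (map (f x ∷_) (prism f g l)) (δ φ)
      ≡⟨ ∑-map (δ φ) (f x ∷_) (prism f g l) ⟩
    ∑ (prism f g l) (λ m → δ φ (f x ∷ m))
      ≡⟨ ∑-cong (prism f g l) (δ-∷ φ (f x)) ⟩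
    ∑ (prism f g l) (λ m → φ m xor δ φₓ m)
      ≡⟨ ∑-xor φ (δ φₓ) (prism f g l) ⟩
    d xor ∑ (prism f g l) (δ φₓ)
      ≡⟨ cong (d xor_) (prism-boundary f g φₓ l) ⟩
    d xor ((e xor b) xor k) ∎
  last : δ (λ m → ∑ (prism f g m) φ) (x ∷ l) ≡ d xor (c xor k)
  last = begin
    δ (λ m → ∑ (prism f g m) φ) (x ∷ l)
      ≡⟨ δ-∷ (λ m → ∑ (prism f g m) φ) x l ⟩
    d xor δ (λ m → ∑ (prism f g (x ∷ m)) φ) l
      ≡⟨ cong (d xor_) (∑-cong (faces l) λ m →
           cong (φ (f x ∷ g x ∷ map g m) xor_) (∑-map φ (f x ∷_) (prism f g m))) ⟩
    d xor ∑ (faces l) (λ m → φₓ (g x ∷ map g m) xor ∑ (prism f g m) φₓ)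
      ≡⟨ cong (d xor_) (∑-xor _ _ (faces l)) ⟩
    d xor (c xor k) ∎

-- Alternating sign sequences

alternates : Bool → List Bool → Bool
alternates b     []          = true
alternates true  (true  ∷ s) = alternates false s
alternates true  (false ∷ s) = false
alternates false (true  ∷ s) = false
alternates false (false ∷ s) = alternates true s

-- Ky Fan's count: the facets of an alternating sequence that alternate from a
-- prescribed sign number one, and those of any other sequence number zero or two.
δ-alternates : ∀ b s → δ (alternates b) s ≡ alternates b s xor alternates (not b) s
δ-alternates b     []       = refl
δ-alternates true  (true ∷ s)
  rewrite δ-∷ (alternates true) true s | δ-alternates false s =
  xorSolve 2 (λ p q → p ⊞ (q ⊞ p) :≡ q ⊞ constant false) refl (alternates true s) (alternates false s)
δ-alternates true  (false ∷ s)
  rewrite δ-∷ (alternates true) false s | ∑-zero (faces s) =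
  xor-identityʳ _
δ-alternates false (true ∷ s)
  rewrite δ-∷ (alternates false) true s | ∑-zero (faces s) =
  xor-identityʳ _
δ-alternates false (false ∷ s)
  rewrite δ-∷ (alternates false) false s | δ-alternates true s =
  xorSolve 2 (λ p q → p ⊞ (q ⊞ p) :≡ q ⊞ constant false) refl (alternates false s) (alternates true s)

-- Sorting by a key, and its effect on faces

module Sort {A : Set} (key : A → ℕ) where

  insert : A → List A → List A
  insert x []      = x ∷ []
  insert x (y ∷ l) with key x ≤? key y
  ... | yes _ = x ∷ y ∷ l
  ... | no  _ = y ∷ insert x l

  sort : List A → List A
  sort []      = []
  sort (x ∷ l) = insert x (sort l)

  Sorted : List A → Set
  Sorted = AllPairs (λ x y → key x ≤ key y)

  insert-∈ : ∀ {z} x l → z ∈ insert x l → z ≡ x ⊎ z ∈ l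
  insert-∈ x []      (here eq) = inj₁ eq
  insert-∈ x (y ∷ l) z∈ with key x ≤? key y
  insert-∈ x (y ∷ l) (here eq)  | yes _ = inj₁ eq
  insert-∈ x (y ∷ l) (there z∈) | yes _ = inj₂ z∈
  insert-∈ x (y ∷ l) (here eq)  | no _  = inj₂ (here eq)
  insert-∈ x (y ∷ l) (there z∈) | no _ with insert-∈ x l z∈
  ... | inj₁ eq  = inj₁ eq
  ... | inj₂ z∈l = inj₂ (there z∈l)

  sort-∈ : ∀ {z} l → z ∈ sort l → z ∈ l
  sort-∈ (x ∷ l) z∈ with insert-∈ x (sort l) z∈
  ... | inj₁ eq  = here eq
  ... | inj₂ z∈l = there (sort-∈ l z∈l)

  length-insert : ∀ x l → length (insert x l) ≡ suc (length l)
  length-insert x []      = refl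
  length-insert x (y ∷ l) with key x ≤? key y
  ... | yes _ = refl
  ... | no  _ = cong suc (length-insert x l)

  length-sort : ∀ l → length (sort l) ≡ length l
  length-sort []      = refl
  length-sort (x ∷ l) = trans (length-insert x (sort l)) (cong suc (length-sort l))

  insert-sorted : ∀ x {l} → Sorted l → Sorted (insert x l)
  insert-sorted x []             = [] ∷ []
  insert-sorted x {y ∷ l} (y≤l ∷ s) with key x ≤? key y
  ... | yes x≤y = (x≤y ∷ All.map (≤-trans x≤y) y≤l) ∷ y≤l ∷ s
  ... | no  x≰y = All.tabulate below ∷ insert-sorted x s
    where
    below : ∀ {z} → z ∈ insert x l → key y ≤ key z
    below z∈ with insert-∈ x l z∈
    ... | inj₁ refl = ≰⇒≥ x≰y
    ... | inj₂ z∈l  = All.lookup y≤l z∈l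

  sort-sorted : ∀ l → Sorted (sort l)
  sort-sorted []      = []
  sort-sorted (x ∷ l) = insert-sorted x (sort-sorted l)

  insert-minimum : ∀ x l → All (λ y → key x ≤ key y) l → insert x l ≡ x ∷ l
  insert-minimum x []      []        = refl
  insert-minimum x (y ∷ l) (x≤y ∷ _) with key x ≤? key y
  ... | yes _   = refl
  ... | no  x≰y = contradiction x≤y x≰y

  -- Deleting the new entry gives back `l`; deleting any other entry can equally be done before the
  -- insertion. Sortedness enters when `x` goes first: it then goes first in every face as well.
  δ-insert : ∀ φ x {l} → Sorted l → δ φ (insert x l) ≡ φ l xor δ (φ ∘ insert x) l
  δ-insert φ x []              = refl
  δ-insert φ x {y ∷ l} (y≤l ∷ s) with key x ≤? key y in eq
  ... | yes x≤y = begin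
    δ φ (x ∷ y ∷ l)
      ≡⟨ δ-∷ φ x (y ∷ l) ⟩
    φ (y ∷ l) xor δ (φ ∘ (x ∷_)) (y ∷ l)
      ≡⟨ cong (φ (y ∷ l) xor_) (∑-cong-All (All.map (λ {m} ps → cong φ (sym (insert-minimum x m ps)))
           (faces-All (x≤y ∷ All.map (≤-trans x≤y) y≤l)))) ⟩
    φ (y ∷ l) xor δ (φ ∘ insert x) (y ∷ l) ∎
    where open ≡-Reasoning
  ... | no x≰y = begin
    δ φ (y ∷ insert x l)
      ≡⟨ δ-∷ φ y (insert x l) ⟩
    φ (insert x l) xor δ (φ ∘ (y ∷_)) (insert x l)
      ≡⟨ cong (φ (insert x l) xor_) (δ-insert (φ ∘ (y ∷_)) x s) ⟩
    φ (insert x l) xor (φ (y ∷ l) xor δ (λ m → φ (y ∷ insert x m)) l)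
      ≡⟨ xorSolve 3 (λ a b c → a ⊞ (b ⊞ c) :≡ b ⊞ (a ⊞ c)) refl (φ (insert x l)) (φ (y ∷ l)) _ ⟩
    φ (y ∷ l) xor (φ (insert x l) xor δ (λ m → φ (y ∷ insert x m)) l)
      ≡⟨ cong (λ b → φ (y ∷ l) xor (φ (insert x l) xor b))
           (∑-cong (faces l) λ m → cong φ (sym (insert-∷ m))) ⟩
    φ (y ∷ l) xor (φ (insert x l) xor δ (λ m → φ (insert x (y ∷ m))) l)
      ≡⟨ cong (φ (y ∷ l) xor_) (δ-∷ (φ ∘ insert x) y l) ⟨
    φ (y ∷ l) xor δ (φ ∘ insert x) (y ∷ l) ∎
    where
    open ≡-Reasoning
    insert-∷ : ∀ m → insert x (y ∷ m) ≡ y ∷ insert x m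
    insert-∷ m rewrite eq = refl

  -- Sorting is a chain map, so Ky Fan's count, made along a key, applies to simplices listed in any
  -- order.
  δ-sort : ∀ φ l → δ (φ ∘ sort) l ≡ δ φ (sort l)
  δ-sort φ []      = refl
  δ-sort φ (x ∷ l) = begin
    δ (φ ∘ sort) (x ∷ l)                          ≡⟨ δ-∷ (φ ∘ sort) x l ⟩
    φ (sort l) xor δ (φ ∘ insert x ∘ sort) l      ≡⟨ cong (φ (sort l) xor_) (δ-sort (φ ∘ insert x) l) ⟩
    φ (sort l) xor δ (φ ∘ insert x) (sort l)      ≡⟨ δ-insert φ x (sort-sorted l) ⟨
    δ φ (insert x (sort l))                       ∎
    where open ≡-Reasoning

open Sort using (insert; sort; sort-∈; sort-sorted; length-sort; δ-sort)

sort-map : ∀ {A B : Set} (f : A → B) (key : B → ℕ) l →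
           sort key (map f l) ≡ map f (sort (key ∘ f) l)
sort-map f key []      = refl
sort-map f key (x ∷ l) =
  trans (cong (insert key (f x)) (sort-map f key l)) (insert-map (sort (key ∘ f) l))
  where
  insert-map : ∀ l → insert key (f x) (map f l) ≡ map f (insert (key ∘ f) x l)
  insert-map []      = refl
  insert-map (y ∷ l) with key (f x) ≤? key (f y)
  ... | yes _ = refl
  ... | no  _ = cong (f y ∷_) (insert-map l)

-- Signed simplices read in a given order

Signed : Set → Set
Signed V = V × Bool

negate : ∀ {V : Set} → Signed V → Signed V
negate (x , s) = x , not s

negate-involutive : ∀ {V : Set} (p : Signed V) → negate (negate p) ≡ p
negate-involutive (x , s) = cong (x ,_) (not-involutive s)

map-negate-involutive : ∀ {V : Set} (l : List (Signed V)) → map negate (map negate l) ≡ l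
map-negate-involutive l =
  trans (sym (map-∘ l)) (trans (map-cong negate-involutive l) (map-id l))

-- Sorting is stable, so vertices with equal values of `c` keep their given order; the cochain makes
-- sense for every `c`.
alternatesBy : ∀ {V : Set} → (V → ℕ) → Bool → List (Signed V) → Bool
alternatesBy c b l = alternates b (map proj₂ (sort (c ∘ proj₁) l))

alternates-not : ∀ b s → alternates b (map not s) ≡ alternates (not b) s
alternates-not b     []          = refl
alternates-not true  (true  ∷ s) = refl
alternates-not true  (false ∷ s) = alternates-not false s
alternates-not false (true  ∷ s) = alternates-not true s
alternates-not false (false ∷ s) = refl

alternatesBy-negate : ∀ {V : Set} (c : V → ℕ) b l →
                      alternatesBy c b (map negate l) ≡ alternatesBy c (not b) l
alternatesBy-negate c b l = begin
  alternates b (map proj₂ (sort (c ∘ proj₁) (map negate l)))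
    ≡⟨ cong (alternates b ∘ map proj₂) (sort-map negate (c ∘ proj₁) l) ⟩
  alternates b (map proj₂ (map negate (sort (c ∘ proj₁) l)))
    ≡⟨ cong (alternates b) (trans (sym (map-∘ (sort (c ∘ proj₁) l))) (map-∘ (sort (c ∘ proj₁) l))) ⟩
  alternates b (map not (map proj₂ (sort (c ∘ proj₁) l)))
    ≡⟨ alternates-not b (map proj₂ (sort (c ∘ proj₁) l)) ⟩
  alternates (not b) (map proj₂ (sort (c ∘ proj₁) l)) ∎
  where open ≡-Reasoning

-- The antipode exchanges the two starting signs, so Ky Fan's count becomes a coboundary: summed
-- over a hemisphere, it compares the sphere with its equator.
δ-alternatesBy : ∀ {V : Set} (c : V → ℕ) b l →
  δ (alternatesBy c b) l ≡ alternatesBy c b l xor alternatesBy c b (map negate l)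
δ-alternatesBy c b l = begin
  δ (alternatesBy c b) l
    ≡⟨ δ-sort (c ∘ proj₁) (alternates b ∘ map proj₂) l ⟩
  δ (alternates b ∘ map proj₂) (sort (c ∘ proj₁) l)
    ≡⟨ δ-map (alternates b) proj₂ (sort (c ∘ proj₁) l) ⟨
  δ (alternates b) (map proj₂ (sort (c ∘ proj₁) l))
    ≡⟨ δ-alternates b (map proj₂ (sort (c ∘ proj₁) l)) ⟩
  alternatesBy c b l xor alternatesBy c (not b) l
    ≡⟨ cong (alternatesBy c b l xor_) (alternatesBy-negate c b l) ⟨
  alternatesBy c b l xor alternatesBy c b (map negate l) ∎
  where open ≡-Reasoning

-- Symmetric cycles in the box complex

Chain : Set → Set
Chain V = List (List (Signed V))

Symmetric : ∀ {V : Set} → Chain V → Set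
Symmetric S = ∀ φ → ∑ S (φ ∘ map negate) ≡ ∑ S φ

Odd : ∀ {V : Set} → Chain V → Set
Odd S = ∀ c → ∑ S (alternatesBy c true) ≡ true

module _ (G : Graph) where
  open Graph G

  -- The simplices of the box complex of G.
  Box : List (Signed V) → Set
  Box l = ∀ {x y} → (x , true) ∈ l → (y , false) ∈ l → Adj x y

  -- A symmetric cycle of the box complex, whose simplices have k vertices, with
  -- nontrivial Ky Fan invariant.
  record Sphere (k : ℕ) : Set where
    field
      chain     : Chain V
      box       : ∀ {l} → l ∈ chain → length l ≡ k × Box l
      closed    : ∀ φ → ∑ chain (δ φ) ≡ false
      symmetric : Symmetric chain
      odd       : Odd chain

  -- `h` is a hemisphere with boundary the equator `T`. Adding its antipode gives a cycle, since by
  -- symmetry the boundary of the antipode is `T` again. By `δ-alternatesBy`, the simplices of both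
  -- hemispheres that alternate from a positive sign have the parity of those of `T`.
  suspend : ∀ {k} (T h : Chain V) → Symmetric T → Odd T →
            (∀ φ → ∑ h (δ φ) ≡ ∑ T φ) →
            (∀ {l} → l ∈ h → length l ≡ k × Box l) → Sphere k
  suspend {k} T h T-symmetric T-odd ∂h≡T h-box = record
    { chain     = h ++ map (map negate) h
    ; box       = box
    ; closed    = λ φ → begin
        ∑ (h ++ map (map negate) h) (δ φ)
          ≡⟨ split (δ φ) ⟩
        ∑ h (δ φ) xor ∑ h (δ φ ∘ map negate)
          ≡⟨ cong (∑ h (δ φ) xor_) (∑-cong h (δ-map φ negate)) ⟩
        ∑ h (δ φ) xor ∑ h (δ (φ ∘ map negate))
          ≡⟨ cong₂ _xor_ (∂h≡T φ) (trans (∂h≡T (φ ∘ map negate)) (T-symmetric φ)) ⟩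
        ∑ T φ xor ∑ T φ
          ≡⟨ xorSolve 1 (λ a → a ⊞ a :≡ constant false) refl (∑ T φ) ⟩
        false ∎
    ; symmetric = λ φ → begin
        ∑ (h ++ map (map negate) h) (φ ∘ map negate)
          ≡⟨ split (φ ∘ map negate) ⟩
        ∑ h (φ ∘ map negate) xor ∑ h (φ ∘ map negate ∘ map negate)
          ≡⟨ cong (∑ h (φ ∘ map negate) xor_) (∑-cong h (cong φ ∘ map-negate-involutive)) ⟩
        ∑ h (φ ∘ map negate) xor ∑ h φ
          ≡⟨ xor-comm (∑ h (φ ∘ map negate)) (∑ h φ) ⟩
        ∑ h φ xor ∑ h (φ ∘ map negate)
          ≡⟨ split φ ⟨
        ∑ (h ++ map (map negate) h) φ ∎
    ; odd       = λ c → begin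
        ∑ (h ++ map (map negate) h) (alternatesBy c true)
          ≡⟨ split (alternatesBy c true) ⟩
        ∑ h (alternatesBy c true) xor ∑ h (alternatesBy c true ∘ map negate)
          ≡⟨ ∑-xor _ _ h ⟨
        ∑ h (λ l → alternatesBy c true l xor alternatesBy c true (map negate l))
          ≡⟨ ∑-cong h (δ-alternatesBy c true) ⟨
        ∑ h (δ (alternatesBy c true))
          ≡⟨ trans (∂h≡T _) (T-odd c) ⟩
        true ∎
    }
    where
    open ≡-Reasoning
    split : ∀ φ → ∑ (h ++ map (map negate) h) φ ≡ ∑ h φ xor ∑ h (φ ∘ map negate)
    split φ = trans (∑-++ φ h _) (cong (∑ h φ xor_) (∑-map φ (map negate) h))
    box : ∀ {l} → l ∈ h ++ map (map negate) h → length l ≡ k × Box l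
    box l∈ with ∈-++⁻ h l∈
    ... | inj₁ l∈h = h-box l∈h
    ... | inj₂ l∈νh with m , m∈ , refl ← ∈-map⁻ (map negate) l∈νh =
      trans (length-map negate m) (proj₁ (h-box m∈)) ,
      λ x∈ y∈ → adj-sym (proj₂ (h-box m∈) (unnegate y∈) (unnegate x∈))
      where
      unnegate : ∀ {p} → p ∈ map negate m → negate p ∈ m
      unnegate p∈ = subst (_ ∈_) (map-negate-involutive m) (∈-map⁺ negate p∈)

module _ {G : Graph} {k : ℕ} (S : Sphere G k) where
  open Graph G
  open Sphere S

  private
    -- Two vertices labelled `u` are never adjacent, so only one sign class can move to them; in the
    -- cone, `w` gets the opposite sign.
    up vv⁺ : Signed V → Signed (MycielskiV V)
    up (a , true)  = a ᵘ , true
    up (a , false) = a ᵛ , false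
    vv⁺ (a , s)    = a ᵛ , s

  -- The prism moves the positive vertices aᵛ of the sphere to aᵘ, all adjacent to w, after
  -- which the cone from w⁻ fills it.
  mycielskiSphere : Sphere (ℳ G) (suc k)
  mycielskiSphere = suspend (ℳ G) T h T-symmetric T-odd ∂h≡T h-box
    where
    open ≡-Reasoning
    T h : Chain (MycielskiV V)
    T = map (map vv⁺) chain
    cone : List (Signed V) → List (Signed (MycielskiV V))
    cone l = (w , false) ∷ map up l
    h = concatMap (prism up vv⁺) chain ++ map cone chain

    T-symmetric : Symmetric T
    T-symmetric φ = begin
      ∑ T (φ ∘ map negate)                    ≡⟨ ∑-map (φ ∘ map negate) (map vv⁺) chain ⟩
      ∑ chain (φ ∘ map negate ∘ map vv⁺)       ≡⟨ ∑-cong chain (λ l → cong φ (trans (sym (map-∘ l)) (map-∘ l))) ⟩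
      ∑ chain (φ ∘ map vv⁺ ∘ map negate)       ≡⟨ symmetric (φ ∘ map vv⁺) ⟩
      ∑ chain (φ ∘ map vv⁺)                    ≡⟨ ∑-map φ (map vv⁺) chain ⟨
      ∑ T φ                                    ∎

    T-odd : Odd T
    T-odd c = begin
      ∑ T (alternatesBy c true)               ≡⟨ ∑-map (alternatesBy c true) (map vv⁺) chain ⟩
      ∑ chain (alternatesBy c true ∘ map vv⁺)  ≡⟨ ∑-cong chain (λ l → cong (alternates true)
                                                  (trans (cong (map proj₂) (sort-map vv⁺ (c ∘ proj₁) l))
                                                         (sym (map-∘ (sort (c ∘ _ᵛ ∘ proj₁) l))))) ⟩
      ∑ chain (alternatesBy (c ∘ _ᵛ) true)     ≡⟨ odd (c ∘ _ᵛ) ⟩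
      true                                     ∎

    ∂h≡T : ∀ φ → ∑ h (δ φ) ≡ ∑ T φ
    ∂h≡T φ = begin
      ∑ h (δ φ)
        ≡⟨ ∑-++ (δ φ) (concatMap (prism up vv⁺) chain) (map cone chain) ⟩
      ∑ (concatMap (prism up vv⁺) chain) (δ φ) xor ∑ (map cone chain) (δ φ)
        ≡⟨ cong₂ _xor_ (∑-concatMap (δ φ) (prism up vv⁺) chain) (∑-map (δ φ) cone chain) ⟩
      ∑ chain (λ l → ∑ (prism up vv⁺ l) (δ φ)) xor ∑ chain (δ φ ∘ cone)
        ≡⟨ cong₂ _xor_ prisms cones ⟩
      (a xor ∑ chain (φ ∘ map vv⁺)) xor a
        ≡⟨ xorSolve 2 (λ a b → (a ⊞ b) ⊞ a :≡ b) refl a (∑ chain (φ ∘ map vv⁺)) ⟩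
      ∑ chain (φ ∘ map vv⁺)
        ≡⟨ ∑-map φ (map vv⁺) chain ⟨
      ∑ T φ ∎
      where
      a = ∑ chain (φ ∘ map up)
      -- The walls of the prisms form a coboundary evaluated on the sphere, which vanishes because
      -- the sphere is closed; likewise for the cones. The copy under `up`, common to both, cancels.
      prisms : ∑ chain (λ l → ∑ (prism up vv⁺ l) (δ φ)) ≡ a xor ∑ chain (φ ∘ map vv⁺)
      prisms = begin
        ∑ chain (λ l → ∑ (prism up vv⁺ l) (δ φ))
          ≡⟨ ∑-cong chain (prism-boundary up vv⁺ φ) ⟩
        ∑ chain (λ l → (φ (map up l) xor φ (map vv⁺ l)) xor δ (λ m → ∑ (prism up vv⁺ m) φ) l)
          ≡⟨ ∑-xor _ _ chain ⟩
        ∑ chain (λ l → φ (map up l) xor φ (map vv⁺ l)) xor ∑ chain (δ (λ m → ∑ (prism up vv⁺ m) φ))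
          ≡⟨ cong₂ _xor_ (∑-xor _ _ chain) (closed _) ⟩
        (a xor ∑ chain (φ ∘ map vv⁺)) xor false
          ≡⟨ xor-identityʳ _ ⟩
        a xor ∑ chain (φ ∘ map vv⁺) ∎
      cones : ∑ chain (δ φ ∘ cone) ≡ a
      cones = begin
        ∑ chain (δ φ ∘ cone)
          ≡⟨ ∑-cong chain (λ l → trans (δ-∷ φ (w , false) (map up l))
               (cong (φ (map up l) xor_) (δ-map (φ ∘ ((w , false) ∷_)) up l))) ⟩
        ∑ chain (λ l → φ (map up l) xor δ (φ ∘ cone) l)
          ≡⟨ ∑-xor _ _ chain ⟩
        a xor ∑ chain (δ (φ ∘ cone))
          ≡⟨ cong (a xor_) (closed (φ ∘ cone)) ⟩
        a xor false
          ≡⟨ xor-identityʳ a ⟩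
        a ∎

    length-prism : ∀ l {m} → m ∈ prism up vv⁺ l → length m ≡ suc (length l)
    length-prism (x ∷ l) (here refl) = cong (λ k → suc (suc k)) (length-map vv⁺ l)
    length-prism (x ∷ l) (there m∈) with m′ , m′∈ , refl ← ∈-map⁻ (up x ∷_) m∈ =
      cong suc (length-prism l m′∈)

    prism-∈ : ∀ l {m p} → m ∈ prism up vv⁺ l → p ∈ m → ∃ λ q → q ∈ l × (p ≡ up q ⊎ p ≡ vv⁺ q)
    prism-∈ (x ∷ l) (here refl) (here eq)          = x , here refl , inj₁ eq
    prism-∈ (x ∷ l) (here refl) (there (here eq))  = x , here refl , inj₂ eq
    prism-∈ (x ∷ l) (here refl) (there (there p∈))
      with q , q∈ , eq ← ∈-map⁻ vv⁺ p∈ = q , there q∈ , inj₂ eq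
    prism-∈ (x ∷ l) (there m∈) p∈ with m′ , m′∈ , refl ← ∈-map⁻ (up x ∷_) m∈ | p∈
    ... | here eq   = x , here refl , inj₁ eq
    ... | there p∈′ with q , q∈ , eq ← prism-∈ l m′∈ p∈′ = q , there q∈ , eq

    prism-box : ∀ l → Box G l → ∀ {m} → m ∈ prism up vv⁺ l → Box (ℳ G) m
    prism-box l l-box m∈ x∈ y∈ with prism-∈ l m∈ x∈ | prism-∈ l m∈ y∈
    ... | (a , true)  , a∈ , inj₁ refl | (b , false) , b∈ , inj₁ refl = uv (l-box a∈ b∈)
    ... | (a , true)  , a∈ , inj₁ refl | (b , false) , b∈ , inj₂ refl = uv (l-box a∈ b∈)
    ... | (a , true)  , a∈ , inj₂ refl | (b , false) , b∈ , inj₁ refl = vv (l-box a∈ b∈)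
    ... | (a , true)  , a∈ , inj₂ refl | (b , false) , b∈ , inj₂ refl = vv (l-box a∈ b∈)

    cone-box : ∀ l → Box G l → Box (ℳ G) (cone l)
    cone-box l l-box (there x∈) y∈ with ∈-map⁻ up x∈ | y∈
    ... | (a , true) , a∈ , refl | here refl = uw
    ... | (a , true) , a∈ , refl | there y∈′ with ∈-map⁻ up y∈′
    ... | (b , false) , b∈ , refl = uv (l-box a∈ b∈)

    h-box : ∀ {l} → l ∈ h → length l ≡ suc k × Box (ℳ G) l
    h-box l∈ with ∈-++⁻ (concatMap (prism up vv⁺) chain) l∈
    ... | inj₁ l∈p with m , m∈ , l∈m ← find (∈-concatMap⁻ (prism up vv⁺) {xs = chain} l∈p) =
      trans (length-prism m l∈m) (cong suc (proj₁ (box m∈))) , prism-box m (proj₂ (box m∈)) l∈m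
    ... | inj₂ l∈c with m , m∈ , refl ← ∈-map⁻ cone l∈c =
      cong suc (trans (length-map up m) (proj₁ (box m∈))) , cone-box m (proj₂ (box m∈))

module _ (G : Graph) (v : ℕ → Graph.V G) (n : ℕ)
         (adjacent : ∀ i → Graph.Adj G (v i) (v (suc i)))
         (v[m]≡v0 : v (suc (n + n)) ≡ v 0) (v[1+m]≡v1 : v (suc (suc (n + n))) ≡ v 1) where

  open Graph G

  private
    _⁺ _⁻ : ℕ → Signed V
    i ⁺ = v i , true
    i ⁻ = v i , false

  -- The edges i⁺ (i+1)⁻ and i⁻ (i+1)⁺ form the double cover of the odd closed walk; it
  -- is the boundary of the triangles i⁺ (i+1)⁻ (i+2)⁺ together with a cone from 0⁺ over
  -- the edges i⁺ (i+2)⁺.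
  oddClosedWalkSphere : Sphere G 3
  oddClosedWalkSphere = suspend G T h T-symmetric T-odd ∂h≡T h-box
    where
    open ≡-Reasoning
    m = suc (n + n)
    -- `edges i` consists of the faces of the first triangle that have both signs. They belong to
    -- consecutive steps of the walk, which `∑-T` realigns; indices up to `m + 1` occur.
    edges triangles : ℕ → Chain V
    edges i     = (suc i ⁻ ∷ suc (suc i) ⁺ ∷ []) ∷ (i ⁺ ∷ suc i ⁻ ∷ []) ∷ []
    triangles i = (i ⁺ ∷ suc i ⁻ ∷ suc (suc i) ⁺ ∷ []) ∷ (0 ⁺ ∷ i ⁺ ∷ suc (suc i) ⁺ ∷ []) ∷ []
    T h : Chain V
    T = concatMap edges (downFrom m)
    h = concatMap triangles (downFrom m)

    ∑-shift₁ : ∀ (f : V → V → Bool) →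
      ∑ (downFrom m) (λ i → f (v (suc i)) (v (suc (suc i)))) ≡
      ∑ (downFrom m) (λ i → f (v i) (v (suc i)))
    ∑-shift₁ f = ∑-shift (λ i → f (v i) (v (suc i))) m (cong₂ f v[m]≡v0 v[1+m]≡v1)

    ∑-shift₂ : ∀ (f : V → Bool) →
      ∑ (downFrom m) (λ i → f (v (suc (suc i)))) ≡ ∑ (downFrom m) (λ i → f (v i))
    ∑-shift₂ f = trans (∑-shift₁ (λ _ → f)) (∑-shift (f ∘ v) m (cong f v[m]≡v0))

    ⁻⁺ ⁺⁻ : (List (Signed V) → Bool) → V → V → Bool
    ⁻⁺ φ x y = φ ((x , false) ∷ (y , true) ∷ [])
    ⁺⁻ φ x y = φ ((x , true) ∷ (y , false) ∷ [])

    ∑-T : ∀ φ → ∑ T φ ≡ ∑ (downFrom m) (λ i → ⁻⁺ φ (v i) (v (suc i)) xor ⁺⁻ φ (v i) (v (suc i)))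
    ∑-T φ = begin
      ∑ T φ
        ≡⟨ ∑-concatMap φ edges (downFrom m) ⟩
      ∑ (downFrom m) (λ i → p (suc i) xor (q i xor false))
        ≡⟨ ∑-cong (downFrom m) (λ i → cong (p (suc i) xor_) (xor-identityʳ (q i))) ⟩
      ∑ (downFrom m) (λ i → p (suc i) xor q i)
        ≡⟨ ∑-xor (p ∘ suc) q (downFrom m) ⟩
      ∑ (downFrom m) (p ∘ suc) xor ∑ (downFrom m) q
        ≡⟨ cong (_xor ∑ (downFrom m) q) (∑-shift₁ (⁻⁺ φ)) ⟩
      ∑ (downFrom m) p xor ∑ (downFrom m) q
        ≡⟨ ∑-xor p q (downFrom m) ⟨
      ∑ (downFrom m) (λ i → p i xor q i) ∎
      where
      p q : ℕ → Bool
      p i = ⁻⁺ φ (v i) (v (suc i))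
      q i = ⁺⁻ φ (v i) (v (suc i))

    T-symmetric : Symmetric T
    T-symmetric φ = trans (∑-T (φ ∘ map negate))
      (trans (∑-cong (downFrom m) λ i → xor-comm (⁺⁻ φ (v i) (v (suc i))) (⁻⁺ φ (v i) (v (suc i))))
             (sym (∑-T φ)))

    T-odd : Odd T
    T-odd c = trans (∑-T (alternatesBy c true))
      (trans (∑-cong (downFrom m) λ i → exactly-one (v i) (v (suc i))) (∑-const-true n))
      where
      -- Of the two signings of an edge, the one whose first end in the sorted order is positive
      -- counts.
      exactly-one : ∀ x y → ⁻⁺ (alternatesBy c true) x y xor ⁺⁻ (alternatesBy c true) x y ≡ true
      exactly-one x y with c x ≤? c y
      ... | yes _ = refl
      ... | no  _ = refl

    ∂h≡T : ∀ φ → ∑ h (δ φ) ≡ ∑ T φ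
    ∂h≡T φ = begin
      ∑ h (δ φ)
        ≡⟨ ∑-concatMap (δ φ) triangles (downFrom m) ⟩
      ∑ (downFrom m) (λ i → ∑ (triangles i) (δ φ))
        ≡⟨ ∑-cong (downFrom m) (λ i →
             xorSolve 5 (λ a b c d e →
                 (a ⊞ (b ⊞ (c ⊞ constant false))) ⊞ ((b ⊞ (d ⊞ (e ⊞ constant false))) ⊞ constant false)
                 :≡ (a ⊞ (c ⊞ constant false)) ⊞ (d ⊞ e))
               refl (⁻⁺ φ (v (suc i)) (v (suc (suc i)))) (φ (i ⁺ ∷ suc (suc i) ⁺ ∷ []))
                    (⁺⁻ φ (v i) (v (suc i))) (ψ (suc (suc i))) (ψ i)) ⟩
      ∑ (downFrom m) (λ i → ∑ (edges i) φ xor (ψ (suc (suc i)) xor ψ i))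
        ≡⟨ ∑-xor (λ i → ∑ (edges i) φ) (λ i → ψ (suc (suc i)) xor ψ i) (downFrom m) ⟩
      ∑ (downFrom m) (λ i → ∑ (edges i) φ) xor ∑ (downFrom m) (λ i → ψ (suc (suc i)) xor ψ i)
        -- A shift by two along the closed walk leaves the sum over the spokes `ψ` unchanged, so
        -- that they cancel.
        ≡⟨ cong₂ _xor_ (sym (∑-concatMap φ edges (downFrom m)))
             (trans (∑-xor (λ i → ψ (suc (suc i))) ψ (downFrom m))
                    (cong (_xor ∑ (downFrom m) ψ) (∑-shift₂ (λ x → φ (0 ⁺ ∷ (x , true) ∷ []))))) ⟩
      ∑ T φ xor (∑ (downFrom m) ψ xor ∑ (downFrom m) ψ)
        ≡⟨ xorSolve 2 (λ a b → a ⊞ (b ⊞ b) :≡ a) refl (∑ T φ) (∑ (downFrom m) ψ) ⟩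
      ∑ T φ ∎
      where
      ψ : ℕ → Bool
      ψ i = φ (0 ⁺ ∷ i ⁺ ∷ [])

    h-box : ∀ {l} → l ∈ h → length l ≡ 3 × Box G l
    h-box l∈ with find (∈-concatMap⁻ triangles {xs = downFrom m} l∈)
    ... | i , _ , here refl = refl , λ where
      (here refl)                 (there (here refl)) → adjacent i
      (there (there (here refl))) (there (here refl)) → adj-sym (adjacent (suc i))
      _                           (here ())
      _                           (there (there (here ())))
      (there (here ()))           _
    -- The second triangle has positive vertices only, so its box condition is vacuous.
    ... | i , _ , there (here refl) = refl , λ where
      _ (here ())
      _ (there (here ()))
      _ (there (there (here ())))

-- Zigzags extracted from spheres

signAt : Bool → ℕ → Bool
signAt b zero    = b
signAt b (suc n) = signAt (not b) n

signAt-not : ∀ b n → signAt (not b) n ≡ not (signAt b n)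
signAt-not b zero    = refl
signAt-not b (suc n) = signAt-not (not b) n

signAt-suc : ∀ b n → signAt b (suc n) ≢ signAt b n
signAt-suc b n eq = not-¬ refl (sym (trans (sym (signAt-not b n)) eq))

alternates-lookup : ∀ {V : Set} b (l : List (Signed V)) → alternates b (map proj₂ l) ≡ true →
                    ∀ i → proj₂ (lookup l i) ≡ signAt b (toℕ i)
alternates-lookup true  ((x , true) ∷ l)  alt zero    = refl
alternates-lookup true  ((x , true) ∷ l)  alt (suc i) = alternates-lookup false l alt i
alternates-lookup false ((x , false) ∷ l) alt zero    = refl
alternates-lookup false ((x , false) ∷ l) alt (suc i) = alternates-lookup true l alt i

lookup-AllPairs : ∀ {A : Set} {R : A → A → Set} {l} → AllPairs R l →
                  ∀ {i j} → i Fin.< j → R (lookup l i) (lookup l j)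
lookup-AllPairs (rs ∷ _)  {zero}  {suc j} _         = All.lookup rs (∈-lookup j)
lookup-AllPairs (_  ∷ ps) {suc i} {suc j} (s≤s i<j) = lookup-AllPairs ps i<j

-- An odd sum has a nonzero term, hence some simplex of the chain alternates when sorted by `c`; the
-- box condition makes its vertices of opposite signs adjacent.
zigzag : ∀ {G k} → Sphere G k → let open Graph G in
  (c : V → ℕ) → (∀ {x y} → Adj x y → c x ≢ c y) →
  Σ (Fin k → V) λ y →
    (∀ {i j} → i Fin.< j → c (y i) < c (y j)) ×
    (∀ {i j} → signAt true (toℕ i) ≢ signAt true (toℕ j) → Adj (y i) (y j))
zigzag {G} {k} S c c-proper with ∑-true _ (Sphere.chain S) (Sphere.odd S c)
... | l , l∈ , alt = subst Zigzag
    (trans (length-sort key l) (proj₁ (Sphere.box S l∈)))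
    (proj₁ ∘ lookup L , increasing , opposite)
  where
  open Graph G
  Zigzag : ℕ → Set
  Zigzag k = Σ (Fin k → V) λ y →
    (∀ {i j} → i Fin.< j → c (y i) < c (y j)) ×
    (∀ {i j} → signAt true (toℕ i) ≢ signAt true (toℕ j) → Adj (y i) (y j))
  key : Signed V → ℕ
  key = c ∘ proj₁
  L = sort key l

  L-box : ∀ {p q} → p ∈ L → q ∈ L → proj₂ p ≢ proj₂ q → Adj (proj₁ p) (proj₁ q)
  L-box {_ , true}  {_ , false} p∈ q∈ _   = proj₂ (Sphere.box S l∈) (sort-∈ key l p∈) (sort-∈ key l q∈)
  L-box {_ , false} {_ , true}  p∈ q∈ _   = adj-sym (proj₂ (Sphere.box S l∈) (sort-∈ key l q∈) (sort-∈ key l p∈))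
  L-box {_ , true}  {_ , true}  _  _  p≢q = contradiction refl p≢q
  L-box {_ , false} {_ , false} _  _  p≢q = contradiction refl p≢q

  opposite : ∀ {i j} → signAt true (toℕ i) ≢ signAt true (toℕ j) →
             Adj (proj₁ (lookup L i)) (proj₁ (lookup L j))
  opposite {i} {j} i≢j = L-box (∈-lookup i) (∈-lookup j) λ eq →
    i≢j (trans (sym (alternates-lookup true L alt i)) (trans eq (alternates-lookup true L alt j)))

  nondecreasing : ∀ {i j} → i Fin.< j → key (lookup L i) ≤ key (lookup L j)
  nondecreasing = lookup-AllPairs (sort-sorted key l)

  increasing : ∀ {i j} → i Fin.< j → key (lookup L i) < key (lookup L j)
  increasing {i} {j} i<j with m≤n⇒m<n∨m≡n i<j
  ... | inj₂ 1+i≡j = ≤∧≢⇒< (nondecreasing i<j) (c-proper (opposite λ eq →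
    signAt-suc true (toℕ i) (trans (cong (signAt true) 1+i≡j) (sym eq))))
  -- The signs at `i` and `j` may agree here; the strict rise comes from the step to `i + 1`.
  ... | inj₁ 1+i<j = <-≤-trans
    (≤∧≢⇒< (nondecreasing i<i⁺) (c-proper (opposite λ eq →
      signAt-suc true (toℕ i) (trans (cong (signAt true) (sym i⁺≡)) (sym eq)))))
    (nondecreasing (subst (_< toℕ j) (sym i⁺≡) 1+i<j))
    where
    i⁺ = fromℕ< (<-trans 1+i<j (toℕ<n j))
    i⁺≡ : toℕ i⁺ ≡ suc (toℕ i)
    i⁺≡ = toℕ-fromℕ< (<-trans 1+i<j (toℕ<n j))
    i<i⁺ : i Fin.< i⁺
    i<i⁺ = subst (toℕ i <_) (sym i⁺≡) (n<1+n (toℕ i))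

-- Monotonic cycles and closed walks

predecessor : ∀ {m} (j : Fin m) → ∃ λ i → i ⟶ j
predecessor {suc m} zero    = fromℕ m , wrap (cong suc (toℕ-fromℕ m)) refl
predecessor {suc m} (suc j) = inject₁ j , step (cong suc (sym (toℕ-inject₁ j)))

suc-% : ∀ t m .{{_ : NonZero m}} → suc t % m ≡ suc (t % m) % m
suc-% t m = trans (%-distribˡ-+ 1 t m)
  (trans (cong (λ a → (1 % m + a) % m) (sym (m%n%n≡m%n t m))) (sym (%-distribˡ-+ 1 (t % m) m)))

mod-⟶ : ∀ m .{{_ : NonZero m}} t → (t mod m) ⟶ (suc t mod m)
mod-⟶ m t with m≤n⇒m<n∨m≡n (m%n<n t m)
... | inj₁ 1+t%m<m = step (begin
  toℕ (suc t mod m)     ≡⟨ toℕ-fromℕ< (m%n<n (suc t) m) ⟩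
  suc t % m             ≡⟨ suc-% t m ⟩
  suc (t % m) % m       ≡⟨ m<n⇒m%n≡m 1+t%m<m ⟩
  suc (t % m)           ≡⟨ cong suc (toℕ-fromℕ< (m%n<n t m)) ⟨
  suc (toℕ (t mod m))   ∎)
  where open ≡-Reasoning
... | inj₂ 1+t%m≡m = wrap
  (trans (cong suc (toℕ-fromℕ< (m%n<n t m))) 1+t%m≡m)
  (begin
  toℕ (suc t mod m)     ≡⟨ toℕ-fromℕ< (m%n<n (suc t) m) ⟩
  suc t % m             ≡⟨ suc-% t m ⟩
  suc (t % m) % m       ≡⟨ cong (_% m) 1+t%m≡m ⟩
  m % m                 ≡⟨ n%n≡0 m ⟩
  0                     ∎)
  where open ≡-Reasoning

-- A closed walk taking p steps forwards and q steps backwards has p ≡ q modulo m, which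
-- is impossible if p + q is odd and less than m.
noShortOddClosedWalk : ∀ m L (y : ℕ → Fin m) →
  (∀ {t} → t < L → Graph.Adj (C m) (y t) (y (suc t))) → y L ≡ y 0 →
  L < m → ∀ j → L ≢ suc (2 * j)
noShortOddClosedWalk m@(suc _) L y adjacent yL≡y0 L<m j L-odd with displacement L ≤-refl
  where
  open +-*-Solver
  -- Moved to the form y₀ + p + a m = yₜ + q + b m, without subtraction.
  displacement : ∀ t → t ≤ L → ∃ λ p → ∃ λ q → ∃ λ a → ∃ λ b →
    p + q ≡ t × toℕ (y 0) + p + a * m ≡ toℕ (y t) + q + b * m
  displacement zero    _   = 0 , 0 , 0 , 0 , refl , refl
  displacement (suc t) t<L
    with p , q , a , b , p+q≡t , eq ← displacement t (<⇒≤ t<L) | adjacent t<L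
  ... | _ , inj₁ (step y′≡) = suc p , q , a , b , cong suc p+q≡t , (begin
    toℕ (y 0) + suc p + a * m        ≡⟨ cong (_+ a * m) (+-suc (toℕ (y 0)) p) ⟩
    suc (toℕ (y 0) + p + a * m)      ≡⟨ cong suc eq ⟩
    suc (toℕ (y t)) + q + b * m      ≡⟨ cong (λ e → e + q + b * m) y′≡ ⟨
    toℕ (y (suc t)) + q + b * m      ∎)
    where open ≡-Reasoning
  ... | _ , inj₁ (wrap y≡ y′≡) = suc p , q , a , suc b , cong suc p+q≡t , (begin
    toℕ (y 0) + suc p + a * m        ≡⟨ cong (_+ a * m) (+-suc (toℕ (y 0)) p) ⟩
    suc (toℕ (y 0) + p + a * m)      ≡⟨ cong suc eq ⟩
    suc (toℕ (y t)) + q + b * m      ≡⟨ cong (λ e → e + q + b * m) y≡ ⟩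
    m + q + b * m                    ≡⟨ solve 3 (λ m q c → m :+ q :+ c := q :+ (m :+ c)) refl m q (b * m) ⟩
    q + suc b * m                    ≡⟨ cong (λ e → e + q + suc b * m) y′≡ ⟨
    toℕ (y (suc t)) + q + suc b * m  ∎)
    where open ≡-Reasoning
  ... | _ , inj₂ (step y≡) = p , suc q , a , b , trans (+-suc p q) (cong suc p+q≡t) , (begin
    toℕ (y 0) + p + a * m            ≡⟨ eq ⟩
    toℕ (y t) + q + b * m            ≡⟨ cong (λ e → e + q + b * m) y≡ ⟩
    suc (toℕ (y (suc t)) + q + b * m) ≡⟨ cong (_+ b * m) (+-suc (toℕ (y (suc t))) q) ⟨
    toℕ (y (suc t)) + suc q + b * m  ∎)
    where open ≡-Reasoning
  ... | _ , inj₂ (wrap y′≡ y≡) = p , suc q , suc a , b , trans (+-suc p q) (cong suc p+q≡t) , (begin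
    toℕ (y 0) + p + suc a * m        ≡⟨ solve 4 (λ x p m c → x :+ p :+ (m :+ c) := m :+ (x :+ p :+ c)) refl
                                          (toℕ (y 0)) p m (a * m) ⟩
    m + (toℕ (y 0) + p + a * m)      ≡⟨ cong (m +_) eq ⟩
    m + (toℕ (y t) + q + b * m)      ≡⟨ cong₂ (λ e f → e + (f + q + b * m)) (sym y′≡) y≡ ⟩
    suc (toℕ (y (suc t))) + (q + b * m) ≡⟨ solve 3 (λ x q c → con 1 :+ x :+ (q :+ c) := x :+ (con 1 :+ q) :+ c)
                                             refl (toℕ (y (suc t))) q (b * m) ⟩
    toℕ (y (suc t)) + suc q + b * m  ∎)
    where open ≡-Reasoning
... | p , q , a , b , p+q≡L , eq =
  even≢odd p j (trans (cong (p +_) (trans (+-identityʳ p) p≡q)) (trans p+q≡L L-odd))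
  where
  open ≡-Reasoning
  p≤L : p ≤ L
  p≤L = subst (p ≤_) p+q≡L (m≤m+n p q)
  q≤L : q ≤ L
  q≤L = subst (q ≤_) p+q≡L (m≤n+m q p)
  eq′ : p + a * m ≡ q + b * m
  eq′ = +-cancelˡ-≡ (toℕ (y 0)) _ _ (begin
    toℕ (y 0) + (p + a * m)  ≡⟨ +-assoc (toℕ (y 0)) p (a * m) ⟨
    toℕ (y 0) + p + a * m    ≡⟨ eq ⟩
    toℕ (y L) + q + b * m    ≡⟨ cong (λ e → toℕ e + q + b * m) yL≡y0 ⟩
    toℕ (y 0) + q + b * m    ≡⟨ +-assoc (toℕ (y 0)) q (b * m) ⟩
    toℕ (y 0) + (q + b * m)  ∎)
  p≡q : p ≡ q
  p≡q = begin
    p                ≡⟨ m<n⇒m%n≡m (≤-<-trans p≤L L<m) ⟨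
    p % m            ≡⟨ [m+kn]%n≡m%n p a m ⟨
    (p + a * m) % m  ≡⟨ cong (_% m) eq′ ⟩
    (q + b * m) % m  ≡⟨ [m+kn]%n≡m%n q b m ⟩
    q % m            ≡⟨ m<n⇒m%n≡m (≤-<-trans q≤L L<m) ⟩
    q                ∎

module _ (f : ℕ → ℕ) (m : ℕ) (increasing : ∀ {t} → t < m → f t < f (suc t)) where

  growth : ∀ a b → a + b ≤ m → f a + b ≤ f (a + b)
  growth a zero    _     rewrite +-identityʳ a | +-identityʳ (f a) = ≤-refl
  growth a (suc b) a+b<m rewrite +-suc a b | +-suc (f a) b =
    ≤-<-trans (growth a b (<⇒≤ a+b<m)) (increasing a+b<m)

  -- The steps before and after `t` each contribute at least their number, which leaves no slack on
  -- either side.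
  tightGrowth : f m ≤ f 0 + m → ∀ {t} → t ≤ m → f t ≡ f 0 + t
  tightGrowth fm≤ {t} t≤m with b , refl ← m≤n⇒∃[o]m+o≡n t≤m = ≤-antisym
    (+-cancelʳ-≤ b _ _ (≤-trans (growth t b ≤-refl) (≤-trans fm≤ (≤-reflexive (sym (+-assoc (f 0) t b))))))
    (growth 0 t (m≤m+n t b))

module _ {G : Graph} (D : ℕ) (g : Graph.V G → ℕ) (g<D : ∀ x → g x < D)
         (g-proper : ∀ {x y} → Graph.Adj G x y → g x ≢ g y)
         (σ : CircularOrdering G)
         (sorted : ∀ {x y} → Inverse.to σ x Fin.< Inverse.to σ y → g x ≤ g y) where

  open Graph G

  private
    lift : ∀ {P : Set} → Dec P → ℕ → ℕ
    lift (yes _) a = a + D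
    lift (no _)  a = a

  module _ {k : ℕ} (c : Cycle G (suc k))
           (monotonic : ∀ {i j l} → i Fin.< j → j Fin.< l →
                        CyclicOrder (Inverse.to σ (Cycle.u c i)) (Inverse.to σ (Cycle.u c j))
                                    (Inverse.to σ (Cycle.u c l))) where
    open Cycle c

    private
      pos : Fin (suc k) → Fin order
      pos = Inverse.to σ ∘ u

      -- The colours read off while going once around the cycle, with D added after the
      -- end of the linear order has been passed.
      lifted : Fin (suc k) → ℕ
      lifted i = lift (pos i Fin.<? pos zero) (g (u i))

      lifted-zero : lifted zero ≡ g (u zero)
      lifted-zero with pos zero Fin.<? pos zero
      ... | yes p<p = contradiction p<p (<-irrefl refl)
      ... | no  _   = refl

      pos-< : ∀ {i j} → i ⟶ j → ¬ pos j Fin.< pos i → pos i Fin.< pos j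
      pos-< i⟶j j≮i = ≤∧≢⇒< (≮⇒≥ j≮i) λ eq → g-proper (adjacent i⟶j)
        (cong g (Injection.injective (↔⇒↣ σ) (toℕ-injective eq)))

      ascent : ∀ {i j} → i ⟶ j → pos i Fin.< pos j → g (u i) < g (u j)
      ascent i⟶j p<q = ≤∧≢⇒< (sorted p<q) (g-proper (adjacent i⟶j))

      -- Between positions on the same side of the end of the order, `sorted` and properness give a
      -- strict rise; passing the end adds `D`, which exceeds every colour. The start is treated
      -- separately because `CyclicOrder` relates three distinct positions.
      lifted-step : ∀ {i j} → toℕ j ≡ suc (toℕ i) → lifted i < lifted j
      lifted-step {zero} {j} eq with pos zero Fin.<? pos zero | pos j Fin.<? pos zero
      ... | yes p<p | _     = contradiction p<p (<-irrefl refl)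
      ... | no _    | yes _ = <-≤-trans (g<D (u zero)) (m≤n+m D _)
      ... | no _    | no q≮0 = ascent (step eq) (pos-< (step eq) q≮0)
      lifted-step {suc i} {j} eq
        with monotonic {zero} {suc i} {j} (s≤s z≤n) (≤-reflexive (sym eq))
           | pos (suc i) Fin.<? pos zero | pos j Fin.<? pos zero
      ... | _ | no _ | yes _ = <-≤-trans (g<D (u (suc i))) (m≤n+m D _)
      ... | inj₁ (_ , p<q)        | no _  | no _  = ascent (step eq) p<q
      ... | inj₂ (inj₁ (p<q , _)) | no _  | no _  = ascent (step eq) p<q
      ... | inj₂ (inj₂ (q<0 , _)) | no _  | no q≮0 = contradiction q<0 q≮0
      ... | inj₁ (0<p , _)        | yes p<0 | _   = contradiction p<0 (<-asym 0<p)
      ... | inj₂ (inj₁ (p<q , _)) | yes _ | yes _ = +-monoˡ-< D (ascent (step eq) p<q)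
      ... | inj₂ (inj₁ (_ , q<0)) | yes _ | no q≮0 = contradiction q<0 q≮0
      ... | inj₂ (inj₂ (_ , 0<p)) | yes p<0 | _   = contradiction p<0 (<-asym 0<p)

      lifted-last : ∀ {i} → i ⟶ zero → lifted i < g (u zero) + D
      lifted-last {i} i⟶0 with pos i Fin.<? pos zero
      ... | yes p<0 = +-monoˡ-< D (ascent i⟶0 p<0)
      ... | no _    = <-≤-trans (g<D (u i)) (m≤n+m D _)

      extended : ℕ → ℕ
      extended t with t <? suc k
      ... | yes t<k = lifted (fromℕ< t<k)
      -- The start met again after one full turn; this closes the sequence at index `suc k`.
      ... | no  _   = g (u zero) + D

      extended-toℕ : ∀ i → extended (toℕ i) ≡ lifted i
      extended-toℕ i with toℕ i <? suc k
      ... | yes i<k = cong lifted (fromℕ<-toℕ i i<k)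
      ... | no  i≮k = contradiction (toℕ<n i) i≮k

      extended-end : extended (suc k) ≡ g (u zero) + D
      extended-end with suc k <? suc k
      ... | yes k<k = contradiction k<k (<-irrefl refl)
      ... | no  _   = refl

      extended-increasing : ∀ {t} → t < suc k → extended t < extended (suc t)
      extended-increasing {t} t<k with t <? suc k | suc t <? suc k
      ... | no t≮k  | _         = contradiction t<k t≮k
      ... | yes t<k | yes 1+t<k = lifted-step
        (trans (toℕ-fromℕ< 1+t<k) (cong suc (sym (toℕ-fromℕ< t<k))))
      ... | yes t<k | no 1+t≮k  = lifted-last
        (wrap (trans (cong suc (toℕ-fromℕ< t<k)) (≤-antisym t<k (≮⇒≥ 1+t≮k))) refl)

    -- One turn raises the lifted colour by `D` in all, in `suc k` steps of at least one.
    monotonic⇒length≤ : suc k ≤ D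
    monotonic⇒length≤ = +-cancelˡ-≤ (g (u zero)) _ _ (subst₂ _≤_
      (cong (_+ suc k) (trans (extended-toℕ zero) lifted-zero)) extended-end
      (growth extended (suc k) extended-increasing 0 (suc k) ≤-refl))

    -- At length `D` every step of the lifted colour is exactly one; taking off the added `D` leaves
    -- the cyclic succession of colours.
    monotonic⇒consecutive : suc k ≡ D → ∀ {i j} → i ⟶ j →
      g (u j) ≡ suc (g (u i)) ⊎ (g (u j) ≡ 0 × suc (g (u i)) ≡ D)
    monotonic⇒consecutive refl = go
      where
      exact : ∀ i → lifted i ≡ g (u zero) + toℕ i
      exact i = begin
        lifted i                ≡⟨ extended-toℕ i ⟨
        extended (toℕ i)        ≡⟨ tightGrowth extended (suc k) extended-increasing
                                     (≤-reflexive (trans extended-end (cong (_+ D) (sym start))))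
                                     (<⇒≤ (toℕ<n i)) ⟩
        extended 0 + toℕ i      ≡⟨ cong (_+ toℕ i) start ⟩
        g (u zero) + toℕ i      ∎
        where
        open ≡-Reasoning
        start : extended 0 ≡ g (u zero)
        start = trans (extended-toℕ zero) lifted-zero

      overflow : ∀ {a b} → a < D → b + D ≡ suc a → b ≡ 0 × suc a ≡ D
      overflow {b = zero}  a<D eq = refl , sym eq
      overflow {b = suc b} a<D eq =
        contradiction a<D (≤⇒≯ (≤-trans (m≤n+m D b) (≤-reflexive (suc-injective eq))))

      go : ∀ {i j} → i ⟶ j → g (u j) ≡ suc (g (u i)) ⊎ (g (u j) ≡ 0 × suc (g (u i)) ≡ D)
      go {i} {j} (step j≡1+i)
        with eq ← trans (exact j) (trans (cong (g (u zero) +_) j≡1+i)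
                    (trans (+-suc _ _) (cong suc (sym (exact i)))))
        with pos i Fin.<? pos zero | pos j Fin.<? pos zero
      ... | no _  | no _  = inj₁ eq
      ... | yes _ | yes _ = inj₁ (+-cancelʳ-≡ D _ _ eq)
      ... | no _  | yes _ = inj₂ (overflow (g<D (u i)) eq)
      ... | yes _ | no _  = contradiction (g<D (u j))
        (≤⇒≯ (≤-trans (m≤n+m D (suc (g (u i)))) (≤-reflexive (sym eq))))
      go {i} {zero} (wrap 1+i≡D refl)
        with eq ← trans (cong suc (exact i)) (trans (sym (+-suc _ _)) (cong (g (u zero) +_) 1+i≡D))
        with pos i Fin.<? pos zero
      ... | yes _ = inj₁ (sym (+-cancelʳ-≡ D _ _ eq))
      ... | no _  = inj₂ (overflow (g<D (u i)) (sym eq))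

-- Sorted orderings

increasing⇒injective : ∀ {k} (f : Fin k → ℕ) → (∀ {i j} → i Fin.< j → f i < f j) →
                       ∀ {i j} → f i ≡ f j → i ≡ j
increasing⇒injective f increasing {i} {j} eq with <-cmp i j
... | tri< i<j _ _ = contradiction eq (<⇒≢ (increasing i<j))
... | tri≈ _ i≡j _ = i≡j
... | tri> _ _ j<i = contradiction (sym eq) (<⇒≢ (increasing j<i))

threshold : ∀ {n} (h : Fin n → ℕ) → (∀ {i j} → i Fin.≤ j → h i ≤ h j) → ∀ a →
  Σ (Fin (suc n)) λ p → (∀ i → toℕ i < toℕ p → h i ≤ a) × (∀ i → toℕ p ≤ toℕ i → a ≤ h i)
threshold {zero}  h mono a = zero , (λ ()) , (λ ())
threshold {suc n} h mono a with h zero ≤? a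
... | no h0≰a = zero , (λ _ ()) , λ i _ → ≤-trans (≰⇒≥ h0≰a) (mono {zero} {i} z≤n)
... | yes h0≤a with p , below , above ← threshold (h ∘ suc) (mono ∘ s≤s) a =
  suc p , (λ { zero _ → h0≤a ; (suc i) (s≤s i<p) → below i i<p })
        , (λ { (suc i) (s≤s p≤i) → above i p≤i })

punchIn-<⁻ : ∀ {n} (p : Fin (suc n)) i → punchIn p i Fin.< p → toℕ i < toℕ p
punchIn-<⁻ (suc p) zero    _         = s≤s z≤n
punchIn-<⁻ (suc p) (suc i) (s≤s i<p) = s≤s (punchIn-<⁻ p i i<p)

punchIn->⁻ : ∀ {n} (p : Fin (suc n)) i → p Fin.< punchIn p i → toℕ p ≤ toℕ i
punchIn->⁻ zero    i       _         = z≤n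
punchIn->⁻ (suc p) (suc i) (s≤s p<i) = s≤s (punchIn->⁻ p i p<i)

-- Insertion sort in terms of permutations: `π` sorts the other elements, and `zero` is inserted at
-- the threshold of its value.
sortingPermutation : ∀ {n} (g : Fin n → ℕ) →
  Σ (Fin n ↔ Fin n) λ π → ∀ {x y} → Inverse.to π x Fin.< Inverse.to π y → g x ≤ g y
sortingPermutation {zero}  g = ↔-id (Fin 0) , λ { {()} }
sortingPermutation {suc n} g with π , sorted ← sortingPermutation (g ∘ suc) =
  insertₚ zero p π , λ {x} {y} → sorted⁺ x y
  where
  mono : ∀ {i j} → i Fin.≤ j → g (suc (Inverse.from π i)) ≤ g (suc (Inverse.from π j))
  mono i≤j with m≤n⇒m<n∨m≡n i≤j
  ... | inj₁ i<j = sorted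
    (subst₂ Fin._<_ (sym (Inverse.strictlyInverseˡ π _)) (sym (Inverse.strictlyInverseˡ π _)) i<j)
  ... | inj₂ i≡j = ≤-reflexive (cong (g ∘ suc ∘ Inverse.from π) (toℕ-injective i≡j))
  cut = threshold (g ∘ suc ∘ Inverse.from π) mono (g zero)
  p = proj₁ cut
  below = proj₁ (proj₂ cut)
  above = proj₂ (proj₂ cut)
  from-to : ∀ x → g (suc (Inverse.from π (Inverse.to π x))) ≡ g (suc x)
  from-to x = cong (g ∘ suc) (Inverse.strictlyInverseʳ π x)
  sorted⁺ : ∀ x y → Inverse.to (insertₚ zero p π) x Fin.< Inverse.to (insertₚ zero p π) y → g x ≤ g y
  sorted⁺ zero    zero    p<p = contradiction p<p (<-irrefl refl)
  sorted⁺ zero    (suc y) p<y = subst (g zero ≤_) (from-to y) (above _ (punchIn->⁻ p _ p<y))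
  sorted⁺ (suc x) zero    x<p = subst (_≤ g zero) (from-to x) (below _ (punchIn-<⁻ p _ x<p))
  sorted⁺ (suc x) (suc y) x<y = sorted (≰⇒> λ y≤x → <⇒≱ x<y (punchIn-mono-≤ p _ _ y≤x))

sortedOrdering : ∀ (G : Graph) (g : Graph.V G → ℕ) → let open Graph G in
  Σ (CircularOrdering G) λ σ → ∀ {x y} → Inverse.to σ x Fin.< Inverse.to σ y → g x ≤ g y
sortedOrdering G g with π , sorted ← sortingPermutation (g ∘ Inverse.from (Graph.enumerate G)) =
  π ↔-∘ enumerate , λ {x} {y} x<y → subst₂ _≤_ (from-to x) (from-to y) (sorted x<y)
  where
  open Graph G
  from-to : ∀ x → g (Inverse.from enumerate (Inverse.to enumerate x)) ≡ g x
  from-to x = cong g (Inverse.strictlyInverseʳ enumerate x)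

-- Iterated Mycielskians

TriangleFree : Graph → Set
TriangleFree G = let open Graph G in ∀ {x y z} → Adj x y → Adj y z → Adj z x → ⊥

-- The neighbours of `w` are labelled `u` and hence mutually non-adjacent, so `w` lies in no
-- triangle; removing the labels from any other triangle gives one of `G`.
ℳ-triangleFree : ∀ {G} → TriangleFree G → TriangleFree (ℳ G)
ℳ-triangleFree free (vv p) (vv q) (vv s) = free p q s
ℳ-triangleFree free (vv p) (vu q) (uv s) = free p q s
ℳ-triangleFree free (uv p) (vv q) (vu s) = free p q s
ℳ-triangleFree free (vu p) (uv q) (vv s) = free p q s
ℳ-triangleFree free (vu _) uw     ()
ℳ-triangleFree free (uv _) (vu _) ()
ℳ-triangleFree free wu     (uv _) ()
ℳ-triangleFree free uw     wu     ()
ℳ-triangleFree free wu     uw     ()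

ℳ^-triangleFree : ∀ {G} d → TriangleFree G → TriangleFree (ℳ^ d G)
ℳ^-triangleFree     zero    free = free
ℳ^-triangleFree {G} (suc d) free = ℳ-triangleFree {ℳ^ d G} (ℳ^-triangleFree d free)

ℳ^-edge : ∀ {G} d → (∃ λ x → ∃ (Graph.Adj G x)) → ∃ λ x → ∃ (Graph.Adj (ℳ^ d G) x)
ℳ^-edge zero    e = e
ℳ^-edge (suc d) e with x , y , xy ← ℳ^-edge d e = x ᵛ , y ᵛ , vv xy

triangleFree⇒cliqueNumber≡2 : ∀ G → TriangleFree G → (∃ λ x → ∃ (Graph.Adj G x)) → IsCliqueNumber G 2
triangleFree⇒cliqueNumber≡2 G free (x , y , xy) = (mk↣ pair-injective , pair-adjacent) , bound
  where
  open Graph G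
  pair : Fin 2 → V
  pair zero       = x
  pair (suc zero) = y
  pair-injective : ∀ {i j} → pair i ≡ pair j → i ≡ j
  pair-injective {zero}     {zero}     _  = refl
  pair-injective {zero}     {suc zero} eq = contradiction xy (adj-irr eq)
  pair-injective {suc zero} {zero}     eq = contradiction xy (adj-irr (sym eq))
  pair-injective {suc zero} {suc zero} _  = refl
  pair-adjacent : ∀ {i j} → i ≢ j → Adj (pair i) (pair j)
  pair-adjacent {zero}     {zero}     i≢j = contradiction refl i≢j
  pair-adjacent {zero}     {suc zero} _   = xy
  pair-adjacent {suc zero} {zero}     _   = adj-sym xy
  pair-adjacent {suc zero} {suc zero} i≢j = contradiction refl i≢j
  bound : ∀ m → HasClique G m → m ≤ 2
  bound 0 _ = z≤n
  bound 1 _ = s≤s z≤n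
  bound 2 _ = s≤s (s≤s z≤n)
  bound (suc (suc (suc m))) (_ , clique) with () ← free
    (clique {zero} {suc zero} λ ()) (clique {suc zero} {suc (suc zero)} λ ())
    (clique {suc (suc zero)} {zero} λ ())

module IteratedMycielskian (G : Graph) (c₀ : Graph.V G → ℕ) (c₀<3 : ∀ x → c₀ x < 3)
                           (c₀-proper : ∀ {x y} → Graph.Adj G x y → c₀ x ≢ c₀ y) where
  open Graph G

  -- Levels are counted from the inside.  A vertex of ℳ^ d G stems either from the vertex
  -- w of some level l (apex l) or from a vertex x of G; in the latter case it is copy j x
  -- if j is the innermost level at which it has the label u, and core x if it has none.
  data Kind : Set where
    core : V → Kind
    copy : ℕ → V → Kind
    apex : ℕ → Kind

  demote : ℕ → Kind → Kind
  demote d (core x)   = copy d x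
  demote d (copy j x) = copy j x
  demote d (apex l)   = apex l

  kind : ∀ d → Graph.V (ℳ^ d G) → Kind
  kind zero    x     = core x
  kind (suc d) w     = apex d
  kind (suc d) (a ᵘ) = demote d (kind d a)
  kind (suc d) (a ᵛ) = kind d a

  -- Chosen so that the copies adjacent to `apex l` have colours at most `l`, below the colour
  -- `2 + l` that precedes its own. Cores are never adjacent to apices, so these may share colours.
  colourOf : ℕ → Kind → ℕ
  colourOf d (core x)   = d + c₀ x
  colourOf d (copy j x) = j
  colourOf d (apex l)   = 3 + l

  colour : ∀ d → Graph.V (ℳ^ d G) → ℕ
  colour d a = colourOf d (kind d a)

  Bounded : ℕ → Kind → Set
  Bounded d (core x)   = ⊤
  Bounded d (copy j x) = j < d
  Bounded d (apex l)   = l < d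

  demote-bounded : ∀ {d} k → Bounded d k → Bounded (suc d) (demote d k)
  demote-bounded (core x)   _ = ≤-refl
  demote-bounded (copy j x) b = m≤n⇒m≤1+n b
  demote-bounded (apex l)   b = m≤n⇒m≤1+n b

  bounded-suc : ∀ {d} k → Bounded d k → Bounded (suc d) k
  bounded-suc (core x)   _ = tt
  bounded-suc (copy j x) b = m≤n⇒m≤1+n b
  bounded-suc (apex l)   b = m≤n⇒m≤1+n b

  kind-bounded : ∀ d a → Bounded d (kind d a)
  kind-bounded zero    x     = tt
  kind-bounded (suc d) w     = ≤-refl
  kind-bounded (suc d) (a ᵘ) = demote-bounded (kind d a) (kind-bounded d a)
  kind-bounded (suc d) (a ᵛ) = bounded-suc (kind d a) (kind-bounded d a)

  -- What adjacency forces on kinds; the converse fails, since outer labels are forgotten. Copies of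
  -- the same level are both labelled `u` there and so not adjacent. Apart from other apices,
  -- `apex l` sees vertices labelled `u` at level `l`, whose innermost such level is at most `l`.
  data _∼_ : Kind → Kind → Set where
    core-core : ∀ {x y} → Adj x y → core x ∼ core y
    core-copy : ∀ {x j y} → Adj x y → core x ∼ copy j y
    copy-core : ∀ {i x y} → Adj x y → copy i x ∼ core y
    copy-copy : ∀ {i x j y} → i ≢ j → Adj x y → copy i x ∼ copy j y
    apex-copy : ∀ {l j y} → j ≤ l → apex l ∼ copy j y
    copy-apex : ∀ {i x l} → i ≤ l → copy i x ∼ apex l
    apex-apex : ∀ {l m} → l ≢ m → apex l ∼ apex m

  ∼-sym : ∀ {k k′} → k ∼ k′ → k′ ∼ k
  ∼-sym (core-core a)     = core-core (adj-sym a)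
  ∼-sym (core-copy a)     = copy-core (adj-sym a)
  ∼-sym (copy-core a)     = core-copy (adj-sym a)
  ∼-sym (copy-copy i≢j a) = copy-copy (i≢j ∘ sym) (adj-sym a)
  ∼-sym (apex-copy j≤l)   = copy-apex j≤l
  ∼-sym (copy-apex i≤l)   = apex-copy i≤l
  ∼-sym (apex-apex l≢m)   = apex-apex (l≢m ∘ sym)

  -- A core turns into a copy of the new level `d`, which by boundedness differs from all earlier
  -- levels.
  demote-∼ : ∀ {d k k′} → Bounded d k′ → k ∼ k′ → demote d k ∼ k′
  demote-∼ _   (core-core a)     = copy-core a
  demote-∼ j<d (core-copy a)     = copy-copy (<⇒≢ j<d ∘ sym) a
  demote-∼ _   (copy-core a)     = copy-core a
  demote-∼ _   (copy-copy i≢j a) = copy-copy i≢j a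
  demote-∼ _   (apex-copy j≤l)   = apex-copy j≤l
  demote-∼ _   (copy-apex i≤l)   = copy-apex i≤l
  demote-∼ _   (apex-apex l≢m)   = apex-apex l≢m

  apex-∼-demote : ∀ {d} k → Bounded d k → apex d ∼ demote d k
  apex-∼-demote (core x)   _   = apex-copy ≤-refl
  apex-∼-demote (copy j x) j<d = apex-copy (<⇒≤ j<d)
  apex-∼-demote (apex l)   l<d = apex-apex (<⇒≢ l<d ∘ sym)

  kind-∼ : ∀ d {a b} → Graph.Adj (ℳ^ d G) a b → kind d a ∼ kind d b
  kind-∼ zero    p              = core-core p
  kind-∼ (suc d) (vv p)         = kind-∼ d p
  kind-∼ (suc d) (uv {b = b} p) = demote-∼ (kind-bounded d b) (kind-∼ d p)
  kind-∼ (suc d) (vu {a = a} p) = ∼-sym (demote-∼ (kind-bounded d a) (∼-sym (kind-∼ d p)))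
  kind-∼ (suc d) (wu {a})       = apex-∼-demote (kind d a) (kind-bounded d a)
  kind-∼ (suc d) (uw {a})       = ∼-sym (apex-∼-demote (kind d a) (kind-bounded d a))

  colour< : ∀ d a → colour d a < d + 3
  colour< d a = go (kind d a) (kind-bounded d a)
    where
    go : ∀ k → Bounded d k → colourOf d k < d + 3
    go (core x)   _   = +-monoʳ-< d (c₀<3 x)
    go (copy j x) j<d = <-≤-trans j<d (m≤m+n d 3)
    go (apex l)   l<d = subst (3 + l <_) (+-comm 3 d) (+-monoʳ-< 3 l<d)

  colour-proper : ∀ d {a b} → Graph.Adj (ℳ^ d G) a b → colour d a ≢ colour d b
  colour-proper d {a} {b} p = go (kind-bounded d a) (kind-bounded d b) (kind-∼ d p)
    where
    go : ∀ {k k′} → Bounded d k → Bounded d k′ → k ∼ k′ → colourOf d k ≢ colourOf d k′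
    go _ _ (core-core xy)     eq = c₀-proper xy (+-cancelˡ-≡ d _ _ eq)
    go _ j<d (core-copy {x} _) eq = <⇒≢ (<-≤-trans j<d (m≤m+n d (c₀ x))) (sym eq)
    go j<d _ (copy-core {y = y} _) eq = <⇒≢ (<-≤-trans j<d (m≤m+n d (c₀ y))) eq
    go _ _ (copy-copy i≢j _) eq = i≢j eq
    go _ _ (apex-copy j≤l) eq = <⇒≢ (≤-<-trans j≤l (m<n+m _ (s≤s z≤n))) (sym eq)
    go _ _ (copy-apex i≤l) eq = <⇒≢ (≤-<-trans i≤l (m<n+m _ (s≤s z≤n))) eq
    go _ _ (apex-apex l≢m) eq = l≢m (+-cancelˡ-≡ 3 _ _ eq)

  colorable : ∀ d → Colorable (ℳ^ d G) (d + 3)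
  colorable d = (λ a → fromℕ< (colour< d a)) , λ {a} {b} p eq → colour-proper d p (begin
    colour d a                     ≡⟨ toℕ-fromℕ< (colour< d a) ⟨
    toℕ (fromℕ< (colour< d a))     ≡⟨ cong toℕ eq ⟩
    toℕ (fromℕ< (colour< d b))     ≡⟨ toℕ-fromℕ< (colour< d b) ⟩
    colour d b                     ∎)
    where open ≡-Reasoning

  before-apex : ∀ d {k l} → k ∼ apex l → 3 + l ≡ suc (colourOf d k) → ∃ λ l′ → k ≡ apex l′ × l ≡ suc l′
  before-apex d (copy-apex i≤l) eq =
    contradiction i≤l (<⇒≱ (≤-trans (m<n+m _ (s≤s z≤n)) (≤-reflexive (suc-injective eq))))
  before-apex d (apex-apex _)   eq = _ , refl , +-cancelˡ-≡ 3 _ _ eq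

  NonApex : Kind → Set
  NonApex k = ∀ l → k ≢ apex l

  base : ∀ k → NonApex k → V
  base (core x)   _  = x
  base (copy j x) _  = x
  base (apex l)   na = contradiction refl (na l)

  base-adjacent : ∀ {k k′} → k ∼ k′ → ∀ na na′ → Adj (base k na) (base k′ na′)
  base-adjacent (core-core a)         na na′ = a
  base-adjacent (core-copy a)         na na′ = a
  base-adjacent (copy-core a)         na na′ = a
  base-adjacent (copy-copy _ a)       na na′ = a
  base-adjacent (apex-copy {l} _)     na na′ = contradiction refl (na l)
  base-adjacent (copy-apex {l = l} _) na na′ = contradiction refl (na′ l)
  base-adjacent (apex-apex {l} _)     na na′ = contradiction refl (na l)

  -- A cycle meeting all colours in their cyclic order avoids the apices: the colour just
  -- below that of an apex occurs next to it only at another apex, which would have to be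
  -- preceded by a third one and so on.  Hence it projects to G.
  projectedWalk : ∀ d {k} (c : Cycle (ℳ^ d G) (suc k)) → let open Cycle c in
    (∀ {i j} → i ⟶ j → colour d (u j) ≡ suc (colour d (u i)) ⊎
                       (colour d (u j) ≡ 0 × suc (colour d (u i)) ≡ d + 3)) →
    Σ (ℕ → V) λ y → (∀ t → Adj (y t) (y (suc t))) × y (suc k) ≡ y 0
  projectedWalk d {k} c consecutive =
    (λ t → x (t mod suc k)) ,
    (λ t → base-adjacent (kind-∼ d (adjacent (mod-⟶ (suc k) t))) (nonApex _) (nonApex _)) ,
    cong x (toℕ-injective (begin
      toℕ (suc k mod suc k)  ≡⟨ toℕ-fromℕ< (m%n<n (suc k) (suc k)) ⟩
      _                      ≡⟨ n%n≡0 (suc k) ⟩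
      0                      ≡⟨ toℕ-fromℕ< (m%n<n 0 (suc k)) ⟨
      toℕ (0 mod suc k)      ∎))
    where
    open ≡-Reasoning
    open Cycle c
    nonApex : ∀ i → NonApex (kind d (u i))
    nonApex i l eq with i′ , i′⟶i ← predecessor i with consecutive i′⟶i
    ... | inj₂ (≡0 , _) with () ← trans (cong (colourOf d) (sym eq)) ≡0
    ... | inj₁ ≡suc
      with l′ , eq′ , l≡ ← before-apex d (subst (kind d (u i′) ∼_) eq (kind-∼ d (adjacent i′⟶i)))
                             (trans (cong (colourOf d) (sym eq)) ≡suc)
      with l | l≡
    -- The recursion goes backwards along the cycle but descends in the level `l`.
    ... | suc .l′ | refl = nonApex i′ l′ eq′
    x : Fin (suc k) → V
    x i = base (kind d (u i)) (nonApex i)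

-- Lower bounds from zigzags

signAt-double : ∀ b n → signAt b (n + n) ≡ b
signAt-double b zero    = refl
signAt-double b (suc n) rewrite +-suc n n | not-involutive b = signAt-double b n

chromaticNumber≥ : ∀ {G k m} → Sphere G k → Colorable G m → k ≤ m
chromaticNumber≥ S (f , proper)
  with y , increasing , _ ← zigzag S (toℕ ∘ f) (λ p → proper p ∘ toℕ-injective) =
  injective⇒≤ {f = f ∘ y} (increasing⇒injective (toℕ ∘ f ∘ y) increasing ∘ cong toℕ)

ordering-proper : ∀ {G} (σ : CircularOrdering G) {x y} → Graph.Adj G x y →
                  toℕ (Inverse.to σ x) ≢ toℕ (Inverse.to σ y)
ordering-proper {G} σ p eq = Graph.adj-irr G (Injection.injective (↔⇒↣ σ) (toℕ-injective eq)) p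

-- A zigzag for the positions under `σ` is met in order. Its last vertex is dropped: with an even
-- number of vertices the two ends have opposite signs and the cycle closes. For `r = 0` this leaves
-- an edge, a monotonic cycle of length two.
monotonicCycle : ∀ {G} r → Sphere G (2 * r + 3) → (σ : CircularOrdering G) →
                 MonotonicCycle G σ (2 * r + 2)
monotonicCycle {G} zero     S σ
  with _ , _ , opposite ← zigzag S (toℕ ∘ Inverse.to σ) (ordering-proper {G} σ) =
  edge (opposite {zero} {suc zero} λ ())
monotonicCycle {G} (suc r′) S σ = cycle
  (record
    { length≥3 = ≤-trans (s≤s (s≤s (s≤s z≤n))) (≤-reflexive
        (solve 1 (λ r → con 4 :+ con 2 :* r := con 2 :* (con 1 :+ r) :+ con 2) refl r′))
    ; vertices = mk↣ {to = u} (λ eq → increasing⇒injective (toℕ ∘ Inverse.to σ ∘ u) u-increasing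
                                 (cong (toℕ ∘ Inverse.to σ) eq))
    ; adjacent = u-adjacent
    })
  (λ i<j j<l → inj₁ (u-increasing i<j , u-increasing j<l))
  where
  open +-*-Solver
  open Graph G
  zig = zigzag S (toℕ ∘ Inverse.to σ) (ordering-proper {G} σ)
  y = proj₁ zig
  increasing = λ {i j} → proj₁ (proj₂ zig) {i} {j}
  opposite = λ {i j} → proj₂ (proj₂ zig) {i} {j}
  k≤ : 2 * suc r′ + 2 ≤ 2 * suc r′ + 3
  k≤ = +-monoʳ-≤ (2 * suc r′) (n≤1+n 2)
  u : Fin (2 * suc r′ + 2) → V
  u i = y (inject≤ i k≤)
  u-increasing : ∀ {i j} → i Fin.< j → toℕ (Inverse.to σ (u i)) < toℕ (Inverse.to σ (u j))
  u-increasing {i} {j} i<j = increasing (subst₂ _<_ (sym (toℕ-inject≤ i k≤)) (sym (toℕ-inject≤ j k≤)) i<j)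
  u-opposite : ∀ {i j} → signAt true (toℕ i) ≢ signAt true (toℕ j) → Adj (u i) (u j)
  u-opposite {i} {j} i≢j = opposite (subst₂ (λ a b → signAt true a ≢ signAt true b)
    (sym (toℕ-inject≤ i k≤)) (sym (toℕ-inject≤ j k≤)) i≢j)
  u-adjacent : ∀ {i j} → i ⟶ j → Adj (u i) (u j)
  u-adjacent {i} {j} (step eq) = u-opposite λ same →
    signAt-suc true (toℕ i) (trans (cong (signAt true) (sym eq)) (sym same))
  u-adjacent {i} {j} (wrap end start) = u-opposite λ same →
    signAt-suc true (toℕ i) (begin
      signAt true (suc (toℕ i))
        ≡⟨ cong (signAt true) end ⟩
      signAt true (2 * suc r′ + 2)
        ≡⟨ cong (signAt true) (solve 1 (λ r →
             con 2 :* (con 1 :+ r) :+ con 2 := (con 2 :+ r) :+ (con 2 :+ r)) refl r′) ⟩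
      signAt true (suc (suc r′) + suc (suc r′))
        ≡⟨ signAt-double true (suc (suc r′)) ⟩
      true
        ≡⟨ cong (signAt true) start ⟨
      signAt true (toℕ j)
        ≡⟨ same ⟨
      signAt true (toℕ i) ∎)
    where open ≡-Reasoning

-- The odd cycle: sphere, triangles and colouring

module OddCycle (n : ℕ) where

  private
    m : ℕ
    m = suc (n + n)

  vertex : ℕ → Fin m
  vertex t = t mod m

  vertex-adjacent : 0 < n → ∀ t → Graph.Adj (C m) (vertex t) (vertex (suc t))
  vertex-adjacent 0<n t = distinct (mod-⟶ m t) , inj₁ (mod-⟶ m t)
    where
    distinct : ∀ {i j : Fin m} → i ⟶ j → i ≢ j
    distinct (step eq) refl = 1+n≢n (sym eq)
    distinct (wrap end start) refl =
      contradiction 0<n (<-irrefl (sym (m+n≡0⇒m≡0 n (trans (suc-injective (sym end)) start))))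

  vertex-periodic : ∀ t → vertex (t + m) ≡ vertex t
  vertex-periodic t = toℕ-injective (trans (toℕ-fromℕ< (m%n<n (t + m) m))
    (trans ([m+n]%n≡m%n t m) (sym (toℕ-fromℕ< (m%n<n t m)))))

  sphere : 0 < n → Sphere (C m) 3
  sphere 0<n = oddClosedWalkSphere (C m) vertex n (vertex-adjacent 0<n) (vertex-periodic 0) (vertex-periodic 1)

  mycielskiSpheres : 0 < n → ∀ d → Sphere (ℳ^ d (C m)) (d + 3)
  mycielskiSpheres 0<n zero    = sphere 0<n
  mycielskiSpheres 0<n (suc d) = mycielskiSphere (mycielskiSpheres 0<n d)

  -- A triangle would be a closed walk of odd length 3, too short to go around `C m`.
  C-triangleFree : 3 < m → TriangleFree (C m)
  C-triangleFree 3<m {x} {y} {z} xy yz zx = noShortOddClosedWalk m 3 walk adjacent refl 3<m 1 refl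
    where
    walk : ℕ → Fin m
    walk 1 = y
    walk 2 = z
    -- Index 3 falls under this clause, which closes the walk.
    walk _ = x
    adjacent : ∀ {t} → t < 3 → Graph.Adj (C m) (walk t) (walk (suc t))
    adjacent {0} _ = xy
    adjacent {1} _ = yz
    adjacent {2} _ = zx
    adjacent {suc (suc (suc _))} (s≤s (s≤s (s≤s ())))

  colour : Fin m → ℕ
  colour i with toℕ i ≟ n + n
  ... | yes _ = 2
  ... | no  _ = if signAt true (toℕ i) then 0 else 1

  colour<3 : ∀ i → colour i < 3
  colour<3 i with toℕ i ≟ n + n
  ... | yes _ = ≤-refl
  ... | no  _ with signAt true (toℕ i)
  ... | true  = s≤s z≤n
  ... | false = s≤s (s≤s z≤n)

  colour-proper : 0 < n → ∀ {i j} → Graph.Adj (C m) i j → colour i ≢ colour j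
  colour-proper 0<n (_ , inj₁ i⟶j) = arc i⟶j
    where
    arc : ∀ {i j} → i ⟶ j → colour i ≢ colour j
    arc {i} {j} i⟶j with toℕ i ≟ n + n | toℕ j ≟ n + n
    arc (step 1+i≡j)     | yes i≡ | yes j≡ = λ _ → 1+n≢n (trans (sym 1+i≡j) (trans j≡ (sym i≡)))
    arc (wrap _ j≡0)     | yes i≡ | yes j≡ = λ _ → <⇒≢ (≤-trans 0<n (m≤m+n n n)) (trans (sym j≡0) j≡)
    arc {i} {j} _        | yes _  | no _ with signAt true (toℕ j)
    ... | true  = λ ()
    ... | false = λ ()
    arc {i} {j} _        | no _  | yes _ with signAt true (toℕ i)
    ... | true  = λ ()
    ... | false = λ ()
    arc (wrap end _)     | no i≢  | no _ = contradiction (suc-injective end) i≢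
    arc {i} {j} (step 1+i≡j) | no _ | no _ = λ eq →
      signAt-suc true (toℕ i) (trans (cong (signAt true) (sym 1+i≡j)) (sym (bit-injective eq)))
      where
      bit-injective : ∀ {a b} → (if a then 0 else 1) ≡ (if b then 0 else 1) → a ≡ b
      bit-injective {true}  {true}  _ = refl
      bit-injective {false} {false} _ = refl
  colour-proper 0<n (i≢j , inj₂ j⟶i) = colour-proper 0<n (i≢j ∘ sym , inj₁ j⟶i) ∘ sym

-- Clique number, chromatic number and circular altitude

module _ (r n : ℕ) (r+1<n : n > r + 1) where

  private
    m : ℕ
    m = suc (n + n)
    G : Graph
    G = ℳ^ (2 * r) (C m)
    0<n : 0 < n
    0<n = ≤-<-trans z≤n r+1<n
    -- From `r + 2 ≤ n` follows `2 * r + 4 ≤ n + n`, so walks of length `2 * r + 3` cannot go around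
    -- the cycle.
    2r+3<m : 2 * r + 3 < m
    2r+3<m = s≤s (≤-trans (≤-trans (n≤1+n _) (≤-reflexive
      (solve 1 (λ r → con 1 :+ (con 2 :* r :+ con 3) :=
                      (con 1 :+ (r :+ con 1)) :+ (con 1 :+ (r :+ con 1))) refl r)))
      (+-mono-≤ r+1<n r+1<n))
      where open +-*-Solver
    open OddCycle n
    open IteratedMycielskian (C m) (OddCycle.colour n) colour<3 (OddCycle.colour-proper n 0<n)
      renaming (colour to colourᴹ; colour-proper to colourᴹ-proper)
    S : Sphere G (2 * r + 3)
    S = mycielskiSpheres 0<n (2 * r)

  cliqueNumber : IsCliqueNumber G 2
  cliqueNumber = triangleFree⇒cliqueNumber≡2 G
    (ℳ^-triangleFree (2 * r) (C-triangleFree (≤-<-trans (m≤n+m 3 (2 * r)) 2r+3<m)))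
    (ℳ^-edge (2 * r) (vertex 0 , vertex 1 , vertex-adjacent 0<n 0))

  chromaticNumber : IsChromaticNumber G (2 * r + 3)
  chromaticNumber = colorable (2 * r) , λ _ → chromaticNumber≥ S

  circularAltitude : IsCircularAltitude G (2 * r + 2)
  circularAltitude = (λ σ → 2 * r + 2 , ≤-refl , monotonicCycle r S σ) , upper
    where
    g : Graph.V G → ℕ
    g = colourᴹ (2 * r)

    short : (σ : CircularOrdering G) →
            (∀ {x y} → Inverse.to σ x Fin.< Inverse.to σ y → g x ≤ g y) →
            ∀ {l} → MonotonicCycle G σ l → l ≤ 2 * r + 2
    short σ sorted (edge _) = m≤n+m 2 (2 * r)
    short σ sorted (cycle {zero} c _) with () ← Cycle.length≥3 c
    short σ sorted (cycle {suc k} c monotonic)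
      with m≤n⇒m<n∨m≡n (monotonic⇒length≤ {G} (2 * r + 3) g (colour< (2 * r))
                          (colourᴹ-proper (2 * r)) σ sorted c monotonic)
    ... | inj₁ k<D = ≤-pred (≤-trans k<D (≤-reflexive (+-suc (2 * r) 2)))
    ... | inj₂ k≡D
      with y , adjacent , closed ← projectedWalk (2 * r) c
             (monotonic⇒consecutive {G} (2 * r + 3) g (colour< (2 * r))
                (colourᴹ-proper (2 * r)) σ sorted c monotonic k≡D) =
      contradiction
        (trans k≡D (solve 1 (λ r → con 2 :* r :+ con 3 := con 1 :+ con 2 :* (con 1 :+ r)) refl r))
        -- The witness `suc r` shows the length odd: it is `1 + 2 * (1 + r)`.
        (noShortOddClosedWalk m (suc k) y (λ _ → adjacent _) closed (subst (_< m) (sym k≡D) 2r+3<m) (suc r))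
      where open +-*-Solver

    upper : ∀ k → ((σ : CircularOrdering G) → ∃ λ l → k ≤ l × MonotonicCycle G σ l) → k ≤ 2 * r + 2
    upper k long with σ , sorted ← sortedOrdering G g with l , k≤l , M ← long σ =
      ≤-trans k≤l (short σ sorted M)

theorem1p2 : (r n : ℕ) → n > r + 1 →
    let G = ℳ^ (2 * r) (C (2 * n + 1)) in
    IsCliqueNumber G 2
    × IsCircularAltitude G (2 * r + 2)
    × IsChromaticNumber G (2 * r + 3)
theorem1p2 r n r+1<n = subst
  (λ m → let G = ℳ^ (2 * r) (C m) in
    IsCliqueNumber G 2 × IsCircularAltitude G (2 * r + 2) × IsChromaticNumber G (2 * r + 3))
  (solve 1 (λ n → con 1 :+ (n :+ n) := con 2 :* n :+ con 1) refl n)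
  (cliqueNumber r n r+1<n , circularAltitude r n r+1<n , chromaticNumber r n r+1<n)
  where open +-*-Solver
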